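{- Let $n>0$ be an integer of length $l$. Then $$\lim_{k\to\infty}\ \sum_{\substack{m:\ \mathrm{ld}_l(m)=n\\ k(m)=k}}\frac1m=b\log\!\left(1+\frac1n\right),$$ where the sum is over all positive integers $m$ whose base-$b$ representation starts with that of $n$ and contains exactly $k$ occurrences of $d$.
   Context: Fix $b\ge2$ and $d\in\{0,\dots,b-1\}$. For an integer $n\ge0$, its length $l(n)$ is the smallest $l\ge0$ with $n<b^l$, and $k(n)$ is the number of occurrences of $d$ in its base-$b$ representation without leading zeros. For $m>0$ of length $q\ge l$, $\mathrm{ld}_l(m)=\lfloor m/b^{q-l}\rfloor$ (only $m$ of length $\ge l$ are considered). -}

module Defs where

open import Data.Bool.Base using (if_then_else_)
open import Data.Fin.Base using (Fin; toℕ)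
import Data.Integer.Base as ℤ
open ℤ using (+_; +[1+_])
import Data.Integer.Properties as ℤ
open import Data.List.Base using (List; map; upTo; filter; length)
import Data.Nat.Base as ℕ
open ℕ using (ℕ; zero; suc)
import Data.Nat.Properties as ℕ
import Data.Nat.DivMod as ℕ
open import Data.Product.Base using (∃; _×_; _,_; proj₁; proj₂)
open import Data.Rational.Base
open import Data.Rational.Properties
import Data.Rational.Unnormalised.Base as ℚᵘ
open ℚᵘ using (mkℚᵘ)
import Data.Rational.Unnormalised.Properties as ℚᵘ
open import Data.Rational.Solver using (module +-*-Solver)
open import Data.Sum.Base using (inj₁; inj₂)
open import Relation.Binary.PropositionalEquality
open import Relation.Nullary.Decidable using (yes; no; does; _×-dec_)
open import Relation.Nullary.Negation using (contradiction)
open import Relation.Unary using (Decidable)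

IsCauchy : (ℕ → ℚ) → Set
IsCauchy x = ∀ ε → 0ℚ < ε →
  ∃ λ N → ∀ i j → N ℕ.≤ i → N ℕ.≤ j → ∣ x i - x j ∣ ≤ ε

record ℝ : Set where
  constructor mkℝ
  field
    seq    : ℕ → ℚ
    cauchy : IsCauchy seq

open ℝ public

-- For the reals x and y: |x - y| ≤ ε.  The slack η is needed because the
-- approximating sequences satisfy the bound only in the limit.
Within : ℚ → ℝ → ℝ → Set
Within ε x y = ∀ η → 0ℚ < η →
  ∃ λ N → ∀ i → N ℕ.≤ i → ∣ seq x i - seq y i ∣ ≤ ε + η

infix 4 _⟶_

_⟶_ : (ℕ → ℝ) → ℝ → Set
x ⟶ y = ∀ ε → 0ℚ < ε → ∃ λ K → ∀ k → K ℕ.≤ k → Within ε (x k) y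

0<1/ : ∀ n .{{_ : ℕ.NonZero n}} → 0ℚ < + 1 / n
0<1/ n = positive⁻¹ (+ 1 / n) {{normalize-pos 1 n}}

*-pos : ∀ {p q} → 0ℚ < p → 0ℚ < q → 0ℚ < p * q
*-pos {p} {q} 0<p 0<q =
  positive⁻¹ (p * q) {{pos*pos⇒pos p {{positive 0<p}} q {{positive 0<q}}}}

*-nonNeg : ∀ {p q} → 0ℚ ≤ p → 0ℚ ≤ q → 0ℚ ≤ p * q
*-nonNeg {p} {q} 0≤p 0≤q =
  nonNegative⁻¹ (p * q)
    {{nonNeg*nonNeg⇒nonNeg p {{nonNegative 0≤p}} q {{nonNegative 0≤q}}}}

*-monoˡ : ∀ {r p q} → 0ℚ ≤ r → p ≤ q → r * p ≤ r * q
*-monoˡ {r} 0≤r = *-monoˡ-≤-nonNeg r {{nonNegative 0≤r}}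

*-monoʳ : ∀ {r p q} → 0ℚ ≤ r → p ≤ q → p * r ≤ q * r
*-monoʳ {r} 0≤r = *-monoʳ-≤-nonNeg r {{nonNegative 0≤r}}

p-p≡0 : ∀ p → p - p ≡ 0ℚ
p-p≡0 = +-inverseʳ

0≤q-p : ∀ {p q} → p ≤ q → 0ℚ ≤ q - p
0≤q-p {p} {q} p≤q = subst (_≤ q - p) (p-p≡0 p) (+-monoˡ-≤ (- p) p≤q)

q-p≤r : ∀ {p q r} → q ≤ p + r → q - p ≤ r
q-p≤r {p} {q} {r} h = subst (q - p ≤_) (cancel p r) (+-monoˡ-≤ (- p) h)
  where
  open +-*-Solver
  cancel : ∀ p r → p + r - p ≡ r
  cancel = solve 2 (λ p r → p :+ r :- p := r) refl

∣p∣≤r : ∀ {p r} → p ≤ r → - p ≤ r → ∣ p ∣ ≤ r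
∣p∣≤r {p} p≤r -p≤r with ∣p∣≡p∨∣p∣≡-p p
... | inj₁ eq = subst (_≤ _) (sym eq) p≤r
... | inj₂ eq = subst (_≤ _) (sym eq) -p≤r

fromℚ : ℚ → ℝ
fromℚ p = mkℝ (λ _ → p) λ ε 0<ε → 0 , λ _ _ _ _ →
  subst (λ z → ∣ z ∣ ≤ ε) (sym (p-p≡0 p)) (<⇒≤ 0<ε)

·-cauchy : ∀ c {x} → IsCauchy x → IsCauchy (λ i → c * x i)
·-cauchy c {x} x-cauchy ε 0<ε = N , bound
  where
  c⁺ = 1ℚ + ∣ c ∣
  0<c⁺ : 0ℚ < c⁺
  0<c⁺ = +-mono-<-≤ {0ℚ} {1ℚ} {0ℚ} (0<1/ 1) (0≤∣p∣ c)
  instance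
    c⁺-pos : Positive c⁺
    c⁺-pos = positive 0<c⁺
    c⁺≢0 : NonZero c⁺
    c⁺≢0 = pos⇒nonZero c⁺
  δ = 1/ c⁺ * ε
  0<δ : 0ℚ < δ
  0<δ = *-pos (positive⁻¹ (1/ c⁺) {{1/pos⇒pos c⁺}}) 0<ε
  N = proj₁ (x-cauchy δ 0<δ)
  bound : ∀ i j → N ℕ.≤ i → N ℕ.≤ j → ∣ c * x i - c * x j ∣ ≤ ε
  bound i j N≤i N≤j = begin
    ∣ c * x i - c * x j ∣      ≡⟨ cong ∣_∣ (factor c (x i) (x j)) ⟩
    ∣ c * (x i - x j) ∣        ≡⟨ ∣p*q∣≡∣p∣*∣q∣ c (x i - x j) ⟩
    ∣ c ∣ * ∣ x i - x j ∣      ≤⟨ *-monoˡ (0≤∣p∣ c) (proj₂ (x-cauchy δ 0<δ) i j N≤i N≤j) ⟩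
    ∣ c ∣ * δ                  ≤⟨ *-monoʳ (<⇒≤ 0<δ) ∣c∣≤c⁺ ⟩
    c⁺ * δ                     ≡⟨ sym (*-assoc c⁺ (1/ c⁺) ε) ⟩
    c⁺ * (1/ c⁺) * ε           ≡⟨ cong (_* ε) (*-inverseʳ c⁺) ⟩
    1ℚ * ε                     ≡⟨ *-identityˡ ε ⟩
    ε                          ∎
    where
    open ≤-Reasoning
    open +-*-Solver
    factor : ∀ c p q → c * p - c * q ≡ c * (p - q)
    factor = solve 3 (λ c p q → c :* p :- c :* q := c :* (p :- q)) refl
    ∣c∣≤c⁺ : ∣ c ∣ ≤ c⁺
    ∣c∣≤c⁺ = subst (_≤ c⁺) (+-identityˡ ∣ c ∣) (+-monoˡ-≤ ∣ c ∣ (<⇒≤ (0<1/ 1)))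

infixl 7 _·_

_·_ : ℚ → ℝ → ℝ
c · x = mkℝ (λ i → c * seq x i) (·-cauchy c (cauchy x))

Σ< : ℕ → (ℕ → ℚ) → ℚ
Σ< zero    f = 0ℚ
Σ< (suc n) f = Σ< n f + f n

-- HasSum P? f s : the sum of f m over all positive integers m satisfying P
-- converges to s.  Terms are added in increasing order of m.
HasSum : {P : ℕ → Set} → Decidable P → ((m : ℕ) → .{{ℕ.NonZero m}} → ℚ) → ℝ → Set
HasSum P? f s =
  (λ M → fromℚ (Σ< M λ i → if does (P? (suc i)) then f (suc i) else 0ℚ)) ⟶ s

-- Left Riemann sum of f from a to b with M pieces of equal length; it is
-- oriented, so b < a is allowed.
riemannSum : (ℚ → ℚ) → ℚ → ℚ → (M : ℕ) → .{{ℕ.NonZero M}} → ℚ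
riemannSum f a b M =
  Σ< M λ i → f (a + + i / M * (b - a)) * ((b - a) * (+ 1 / M))

-- Multiplicative inverse, with the junk value recip 0 = 0.
recip : ℚ → ℚ
recip p with p ≟ 0ℚ
... | yes _   = 0ℚ
... | no  p≢0 = (1/ p) {{≢-nonZero p≢0}}

Σ-cong : ∀ n {f g : ℕ → ℚ} → (∀ i → f i ≡ g i) → Σ< n f ≡ Σ< n g
Σ-cong zero    f≡g = refl
Σ-cong (suc n) f≡g = cong₂ _+_ (Σ-cong n f≡g) (f≡g n)

Σ-mono : ∀ n {f g : ℕ → ℚ} → (∀ i → i ℕ.< n → f i ≤ g i) → Σ< n f ≤ Σ< n g
Σ-mono zero    f≤g = ≤-refl
Σ-mono (suc n) f≤g =
  +-mono-≤ (Σ-mono n λ i i<n → f≤g i (ℕ.m≤n⇒m≤1+n i<n)) (f≤g n ℕ.≤-refl)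

Σ-split : ∀ m n f → Σ< (m ℕ.+ n) f ≡ Σ< m f + Σ< n (λ j → f (m ℕ.+ j))
Σ-split m zero f rewrite ℕ.+-identityʳ m = sym (+-identityʳ _)
Σ-split m (suc n) f rewrite ℕ.+-suc m n | Σ-split m n f =
  +-assoc (Σ< m f) (Σ< n (λ j → f (m ℕ.+ j))) (f (m ℕ.+ n))

Σ-blocks : ∀ m k f → Σ< (m ℕ.* k) f ≡ Σ< m (λ i → Σ< k (λ j → f (i ℕ.* k ℕ.+ j)))
Σ-blocks zero    k f = refl
Σ-blocks (suc m) k f = begin
  Σ< (k ℕ.+ m ℕ.* k) f                                    ≡⟨ cong (λ z → Σ< z f) (ℕ.+-comm k (m ℕ.* k)) ⟩
  Σ< (m ℕ.* k ℕ.+ k) f                                    ≡⟨ Σ-split (m ℕ.* k) k f ⟩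
  Σ< (m ℕ.* k) f + Σ< k (λ j → f (m ℕ.* k ℕ.+ j))         ≡⟨ cong (λ z → z + Σ< k (λ j → f (m ℕ.* k ℕ.+ j))) (Σ-blocks m k f) ⟩
  _                                                       ∎
  where open ≡-Reasoning

Σ-shift : ∀ n f → Σ< n f + f n ≡ f 0 + Σ< n (λ i → f (suc i))
Σ-shift zero    f = trans (+-identityˡ (f 0)) (sym (+-identityʳ (f 0)))
Σ-shift (suc n) f = trans (cong (_+ f (suc n)) (Σ-shift n f)) (+-assoc (f 0) _ (f (suc n)))

ι : ℕ → ℚ
ι n = + n / 1

toℚᵘ-/ : ∀ a b → toℚᵘ (+ a / suc b) ℚᵘ.≃ mkℚᵘ (+ a) b
toℚᵘ-/ a b = toℚᵘ-fromℚᵘ (mkℚᵘ (+ a) b)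

/-mono : ∀ a b c d → a ℕ.* suc d ℕ.≤ c ℕ.* suc b → + a / suc b ≤ + c / suc d
/-mono a b c d h = toℚᵘ-cancel-≤ (ℚᵘ.≤-respˡ-≃ (ℚᵘ.≃-sym (toℚᵘ-/ a b))
  (ℚᵘ.≤-respʳ-≃ (ℚᵘ.≃-sym (toℚᵘ-/ c d))
    (ℚᵘ.*≤* (subst₂ ℤ._≤_ (ℤ.pos-* a (suc d)) (ℤ.pos-* c (suc b)) (ℤ.+≤+ h)))))

/-≡ : ∀ a b c d → a ℕ.* suc d ≡ c ℕ.* suc b → + a / suc b ≡ + c / suc d
/-≡ a b c d h = ≤-antisym (/-mono a b c d (ℕ.≤-reflexive h))
                          (/-mono c d a b (ℕ.≤-reflexive (sym h)))

ι-suc : ∀ n → ι (suc n) ≡ ι n + 1ℚ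
ι-suc n = toℚᵘ-injective (begin
  toℚᵘ (ι (suc n))                 ≈⟨ toℚᵘ-/ (suc n) 0 ⟩
  mkℚᵘ (+ suc n) 0                 ≈⟨ ℚᵘ.*≡* (cong (ℤ._* + 1) eq) ⟩
  mkℚᵘ (+ n) 0 ℚᵘ.+ mkℚᵘ (+ 1) 0   ≈⟨ ℚᵘ.+-cong (ℚᵘ.≃-sym (toℚᵘ-/ n 0)) (ℚᵘ.≃-sym (toℚᵘ-/ 1 0)) ⟩
  toℚᵘ (ι n) ℚᵘ.+ toℚᵘ 1ℚ          ≈⟨ ℚᵘ.≃-sym (toℚᵘ-homo-+ (ι n) 1ℚ) ⟩
  toℚᵘ (ι n + 1ℚ)                  ∎)
  where
  open ℚᵘ.≃-Reasoning
  eq : + suc n ≡ + n ℤ.* + 1 ℤ.+ + 1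
  eq = sym (trans (cong (ℤ._+ + 1) (ℤ.*-identityʳ (+ n))) (ℤ.+-comm (+ n) (+ 1)))

ι*1/ : ∀ m k → ι (suc k) * (+ 1 / (suc m ℕ.* suc k)) ≡ + 1 / suc m
ι*1/ m k = toℚᵘ-injective (begin
  toℚᵘ (ι (suc k) * (+ 1 / (suc m ℕ.* suc k)))
    ≈⟨ toℚᵘ-homo-* (ι (suc k)) (+ 1 / (suc m ℕ.* suc k)) ⟩
  toℚᵘ (ι (suc k)) ℚᵘ.* toℚᵘ (+ 1 / (suc m ℕ.* suc k))
    ≈⟨ ℚᵘ.*-cong (toℚᵘ-/ (suc k) 0) (toℚᵘ-/ 1 (k ℕ.+ m ℕ.* suc k)) ⟩
  mkℚᵘ (+ suc k) 0 ℚᵘ.* mkℚᵘ (+ 1) (k ℕ.+ m ℕ.* suc k)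
    ≈⟨ ℚᵘ.*≡* (cong (λ z → + z) eq) ⟩
  mkℚᵘ (+ 1) m
    ≈⟨ ℚᵘ.≃-sym (toℚᵘ-/ 1 m) ⟩
  toℚᵘ (+ 1 / suc m) ∎)
  where
  open ℚᵘ.≃-Reasoning
  eq : suc k ℕ.* 1 ℕ.* suc m ≡ 1 ℕ.* (1 ℕ.* (suc m ℕ.* suc k))
  eq = trans (cong (ℕ._* suc m) (ℕ.*-identityʳ (suc k)))
      (trans (ℕ.*-comm (suc k) (suc m))
      (sym (trans (ℕ.*-identityˡ (1 ℕ.* (suc m ℕ.* suc k)))
                  (ℕ.*-identityˡ (suc m ℕ.* suc k)))))

Σ-const : ∀ n c → Σ< n (λ _ → c) ≡ ι n * c
Σ-const zero    c = sym (*-zeroˡ c)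
Σ-const (suc n) c = begin
  Σ< n (λ _ → c) + c   ≡⟨ cong₂ _+_ (Σ-const n c) (sym (*-identityˡ c)) ⟩
  ι n * c + 1ℚ * c     ≡⟨ sym (*-distribʳ-+ c (ι n) 1ℚ) ⟩
  (ι n + 1ℚ) * c       ≡⟨ cong (_* c) (sym (ι-suc n)) ⟩
  ι (suc n) * c        ∎
  where open ≡-Reasoning

archimedean : ∀ C ε → 0ℚ ≤ C → 0ℚ < ε →
  ∃ λ N → ∀ n → N ℕ.≤ n → C * (+ 1 / suc n) ≤ ε
archimedean (mkℚ ℤ.-[1+ _ ] _ _) _ (*≤* ()) _
archimedean _ (mkℚ (+ 0) _ _) _ (*<* (ℤ.+<+ ()))
archimedean _ (mkℚ ℤ.-[1+ _ ] _ _) _ (*<* ())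
archimedean C@(mkℚ (+ a) d _) ε@(mkℚ +[1+ e ] g _) 0≤C 0<ε =
  a ℕ.* suc g , λ n N≤n → toℚᵘ-cancel-≤
    (ℚᵘ.≤-respˡ-≃ (ℚᵘ.≃-sym (ℚᵘ.≃-trans (toℚᵘ-homo-* C (+ 1 / suc n))
                                        (ℚᵘ.*-congˡ {mkℚᵘ (+ a) d} (toℚᵘ-/ 1 n))))
      (ℚᵘ.*≤* (subst₂ ℤ._≤_ (lhs n) (ℤ.pos-* (suc e) _) (ℤ.+≤+ (ineq n N≤n)))))
  where
  lhs : ∀ n → + (a ℕ.* 1 ℕ.* suc g) ≡ + a ℤ.* + 1 ℤ.* + suc g
  lhs n = trans (ℤ.pos-* (a ℕ.* 1) (suc g)) (cong (ℤ._* + suc g) (ℤ.pos-* a 1))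
  open ℕ.≤-Reasoning
  ineq : ∀ n → a ℕ.* suc g ℕ.≤ n → a ℕ.* 1 ℕ.* suc g ℕ.≤ suc e ℕ.* (suc d ℕ.* suc n)
  ineq n h = begin
    a ℕ.* 1 ℕ.* suc g               ≡⟨ cong (ℕ._* suc g) (ℕ.*-identityʳ a) ⟩
    a ℕ.* suc g                     ≤⟨ h ⟩
    n                               ≤⟨ ℕ.n≤1+n n ⟩
    suc n                           ≤⟨ ℕ.m≤n*m (suc n) (suc d) ⟩
    suc d ℕ.* suc n                 ≤⟨ ℕ.m≤n*m (suc d ℕ.* suc n) (suc e) ⟩
    suc e ℕ.* (suc d ℕ.* suc n)     ∎

module Antitone
  (φ : ℚ → ℚ)
  (anti : ∀ r s → 0ℚ ≤ r → r ≤ s → s ≤ 1ℚ → φ s ≤ φ r)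
  where

  U : ℕ → ℚ
  U m = Σ< (suc m) λ i → φ (+ i / suc m) * (+ 1 / suc m)

  C : ℚ
  C = φ 0ℚ - φ 1ℚ

  0≤C : 0ℚ ≤ C
  0≤C = 0≤q-p (anti 0ℚ 1ℚ ≤-refl (<⇒≤ (0<1/ 1)) ≤-refl)

  0≤/ : ∀ i m → 0ℚ ≤ + i / suc m
  0≤/ i m = nonNegative⁻¹ (+ i / suc m) {{normalize-nonNeg i (suc m)}}

  /≤1 : ∀ i m → i ℕ.≤ suc m → + i / suc m ≤ 1ℚ
  /≤1 i m h = /-mono i m 1 0
    (subst₂ ℕ._≤_ (sym (ℕ.*-identityʳ i)) (sym (ℕ.*-identityˡ (suc m))) h)

  module _ (m k : ℕ) where
    private
      M = suc m
      K = suc k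
      mk = k ℕ.+ m ℕ.* suc k
      w = + 1 / suc mk
      0≤w : 0ℚ ≤ w
      0≤w = 0≤/ 1 mk

      g : ℕ → ℚ
      g i = φ (+ i / suc mk) * w

      h : ℕ → ℚ
      h i = φ (+ i / M) * (+ 1 / M)

      lower-node : ∀ i j → + i / M ≤ + (i ℕ.* K ℕ.+ j) / suc mk
      lower-node i j = /-mono i m (i ℕ.* K ℕ.+ j) mk (begin
        i ℕ.* (M ℕ.* K)            ≡⟨ cong (i ℕ.*_) (ℕ.*-comm M K) ⟩
        i ℕ.* (K ℕ.* M)            ≡⟨ sym (ℕ.*-assoc i K M) ⟩
        i ℕ.* K ℕ.* M              ≤⟨ ℕ.*-monoˡ-≤ M (ℕ.m≤m+n (i ℕ.* K) j) ⟩
        (i ℕ.* K ℕ.+ j) ℕ.* M      ∎)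
        where open ℕ.≤-Reasoning

      end-node : ∀ i j → j ℕ.< K → i ℕ.* K ℕ.+ j ℕ.≤ suc i ℕ.* K
      end-node i j j<K = subst (i ℕ.* K ℕ.+ j ℕ.≤_) (ℕ.+-comm (i ℕ.* K) K)
        (ℕ.+-monoʳ-≤ (i ℕ.* K) (ℕ.<⇒≤ j<K))

      upper-node : ∀ i j → j ℕ.< K → + (i ℕ.* K ℕ.+ j) / suc mk ≤ + suc i / M
      upper-node i j j<K = /-mono (i ℕ.* K ℕ.+ j) mk (suc i) m (begin
        (i ℕ.* K ℕ.+ j) ℕ.* M      ≤⟨ ℕ.*-monoˡ-≤ M (end-node i j j<K) ⟩
        suc i ℕ.* K ℕ.* M          ≡⟨ ℕ.*-assoc (suc i) K M ⟩
        suc i ℕ.* (K ℕ.* M)        ≡⟨ cong (suc i ℕ.*_) (ℕ.*-comm K M) ⟩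
        suc i ℕ.* (M ℕ.* K)        ∎)
        where open ℕ.≤-Reasoning

      fine≤1 : ∀ i j → i ℕ.< M → j ℕ.< K → + (i ℕ.* K ℕ.+ j) / suc mk ≤ 1ℚ
      fine≤1 i j i<M j<K =
        /≤1 (i ℕ.* K ℕ.+ j) mk (ℕ.≤-trans (end-node i j j<K) (ℕ.*-monoˡ-≤ K i<M))

      block : ∀ r → Σ< K (λ _ → r * w) ≡ r * (+ 1 / M)
      block r = begin
        Σ< K (λ _ → r * w)   ≡⟨ Σ-const K (r * w) ⟩
        ι K * (r * w)        ≡⟨ swap (ι K) r w ⟩
        r * (ι K * w)        ≡⟨ cong (r *_) (ι*1/ m k) ⟩
        r * (+ 1 / M)        ∎
        where
        open ≡-Reasoning
        open +-*-Solver
        swap : ∀ a b c → a * (b * c) ≡ b * (a * c)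
        swap = solve 3 (λ a b c → a :* (b :* c) := b :* (a :* c)) refl

    refine-≤ : U mk ≤ U m
    refine-≤ = begin
      U mk                                         ≡⟨ Σ-blocks M K g ⟩
      Σ< M (λ i → Σ< K (λ j → g (i ℕ.* K ℕ.+ j)))
        ≤⟨ Σ-mono M (λ i i<M → Σ-mono K (λ j j<K → *-monoʳ 0≤w
             (anti (+ i / M) (+ (i ℕ.* K ℕ.+ j) / suc mk)
               (0≤/ i m) (lower-node i j) (fine≤1 i j i<M j<K)))) ⟩
      Σ< M (λ i → Σ< K (λ j → φ (+ i / M) * w))    ≡⟨ Σ-cong M (λ i → block (φ (+ i / M))) ⟩
      U m                                          ∎
      where open ≤-Reasoning

    refine-≥ : U m ≤ U mk + C * (+ 1 / M)
    refine-≥ = begin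
      U m                                          ≡⟨ rearrange (U m) (h M) (h 0) R (Σ-shift M h) ⟩
      R + (h 0 - h M)                              ≡⟨ cong (λ z → R + z) diff ⟩
      R + C * (+ 1 / M)                            ≤⟨ +-monoˡ-≤ (C * (+ 1 / M)) R≤ ⟩
      U mk + C * (+ 1 / M)                         ∎
      where
      open ≤-Reasoning
      R = Σ< M (λ i → h (suc i))
      rearrange : ∀ u a b r → u + a ≡ b + r → u ≡ r + (b - a)
      rearrange u a b r eq = trans (s₁ u a) (trans (cong (_- a) eq) (s₂ b r a))
        where
        open +-*-Solver
        s₁ : ∀ u a → u ≡ u + a - a
        s₁ = solve 2 (λ u a → u := u :+ a :- a) refl
        s₂ : ∀ b r a → b + r - a ≡ r + (b - a)
        s₂ = solve 3 (λ b r a → b :+ r :- a := r :+ (b :- a)) refl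
      diff : h 0 - h M ≡ C * (+ 1 / M)
      diff = trans
        (cong₂ (λ p q → φ p * (+ 1 / M) - φ q * (+ 1 / M))
          (/-≡ 0 m 0 0 refl) (/-≡ M m 1 0 (ℕ.*-comm M 1)))
        (factor (φ 0ℚ) (φ 1ℚ) (+ 1 / M))
        where
        open +-*-Solver
        factor : ∀ a b c → a * c - b * c ≡ (a - b) * c
        factor = solve 3 (λ a b c → a :* c :- b :* c := (a :- b) :* c) refl
      R≤ : R ≤ U mk
      R≤ = begin
        R                                            ≡⟨ Σ-cong M (λ i → sym (block (φ (+ suc i / M)))) ⟩
        Σ< M (λ i → Σ< K (λ j → φ (+ suc i / M) * w))
          ≤⟨ Σ-mono M (λ i i<M → Σ-mono K (λ j j<K → *-monoʳ 0≤w
               (anti (+ (i ℕ.* K ℕ.+ j) / suc mk) (+ suc i / M)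
                 (0≤/ (i ℕ.* K ℕ.+ j) mk) (upper-node i j j<K) (/≤1 (suc i) m i<M)))) ⟩
        Σ< M (λ i → Σ< K (λ j → g (i ℕ.* K ℕ.+ j)))  ≡⟨ sym (Σ-blocks M K g) ⟩
        U mk                                         ∎

  diff-≤ : ∀ m k → U m - U k ≤ C * (+ 1 / suc m)
  diff-≤ m k = q-p≤r (≤-trans (refine-≥ m k) (+-monoˡ-≤ _ Umk≤Uk))
    where
    Umk≤Uk : U (k ℕ.+ m ℕ.* suc k) ≤ U k
    Umk≤Uk = subst (λ z → U z ≤ U k)
      (ℕ.suc-injective (ℕ.*-comm (suc k) (suc m))) (refine-≤ k m)

  U-cauchy : IsCauchy U
  U-cauchy ε 0<ε with archimedean C ε 0≤C 0<ε
  ... | N , small = N , λ i j N≤i N≤j → ∣p∣≤r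
    (≤-trans (diff-≤ i j) (small i N≤i))
    (subst (_≤ ε) (flip (U j) (U i)) (≤-trans (diff-≤ j i) (small j N≤j)))
    where
    open +-*-Solver
    flip : ∀ p q → p - q ≡ - (q - p)
    flip = solve 2 (λ p q → p :- q := :- (q :- p)) refl

recip-inverse : ∀ p → 0ℚ < p → p * recip p ≡ 1ℚ
recip-inverse p 0<p with p ≟ 0ℚ
... | yes p≡0 = contradiction (sym p≡0) (<⇒≢ 0<p)
... | no  p≢0 = *-inverseʳ p {{≢-nonZero p≢0}}

recip-pos : ∀ p → 0ℚ < p → 0ℚ < recip p
recip-pos p 0<p with p ≟ 0ℚ
... | yes p≡0 = contradiction (sym p≡0) (<⇒≢ 0<p)
... | no  p≢0 = positive⁻¹ _ {{1/pos⇒pos p {{positive 0<p}}}}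

0≤p² : ∀ p → 0ℚ ≤ p * p
0≤p² p with ≤-total 0ℚ p
... | inj₁ 0≤p = *-nonNeg 0≤p 0≤p
... | inj₂ p≤0 = subst (0ℚ ≤_) (neg² p) (*-nonNeg 0≤-p 0≤-p)
  where
  open +-*-Solver
  0≤-p : 0ℚ ≤ - p
  0≤-p = neg-antimono-≤ p≤0
  neg² : ∀ p → - p * - p ≡ p * p
  neg² = solve 1 (λ p → (:- p) :* (:- p) := p :* p) refl

reciprocal-anti : ∀ a b r s c → 0ℚ ≤ a → 0ℚ ≤ b → r ≤ s →
  (1ℚ + r * c) * a ≡ 1ℚ → (1ℚ + s * c) * b ≡ 1ℚ → b * c ≤ a * c
reciprocal-anti a b r s c 0≤a 0≤b r≤s inv-a inv-b = begin
  b * c                   ≡⟨ sym (+-identityʳ (b * c)) ⟩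
  b * c + 0ℚ              ≤⟨ +-monoʳ-≤ (b * c) 0≤D ⟩
  b * c + D               ≡⟨ expand a b r s c ⟩
  b * c * (1ℚ - (1ℚ + r * c) * a) + a * c * ((1ℚ + s * c) * b)
                          ≡⟨ cong₂ (λ p q → b * c * (1ℚ - p) + a * c * q) inv-a inv-b ⟩
  b * c * (1ℚ - 1ℚ) + a * c * 1ℚ
                          ≡⟨ collapse a b c ⟩
  a * c                   ∎
  where
  open ≤-Reasoning
  D = a * b * ((s - r) * (c * c))
  0≤D : 0ℚ ≤ D
  0≤D = *-nonNeg (*-nonNeg 0≤a 0≤b) (*-nonNeg (0≤q-p r≤s) (0≤p² c))
  open +-*-Solver
  expand : ∀ a b r s c → b * c + a * b * ((s - r) * (c * c)) ≡
    b * c * (1ℚ - (1ℚ + r * c) * a) + a * c * ((1ℚ + s * c) * b)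
  expand = solve 5 (λ a b r s c →
    b :* c :+ a :* b :* ((s :- r) :* (c :* c)) :=
    b :* c :* (con 1ℚ :- (con 1ℚ :+ r :* c) :* a) :+ a :* c :* ((con 1ℚ :+ s :* c) :* b)) refl
  collapse : ∀ a b c → b * c * (1ℚ - 1ℚ) + a * c * 1ℚ ≡ a * c
  collapse = solve 3 (λ a b c → b :* c :* (con 1ℚ :- con 1ℚ) :+ a :* c :* con 1ℚ := a :* c) refl

IsCauchy-resp : ∀ {x y} → (∀ i → x i ≡ y i) → IsCauchy y → IsCauchy x
IsCauchy-resp x≡y y-cauchy ε 0<ε with y-cauchy ε 0<ε
... | N , bound = N , λ i j N≤i N≤j →
  subst₂ (λ p q → ∣ p - q ∣ ≤ ε) (sym (x≡y i)) (sym (x≡y j)) (bound i j N≤i N≤j)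

module Log (x : ℚ) (0<x : 0ℚ < x) where

  c = x - 1ℚ

  node : ℚ → ℚ
  node r = 1ℚ + r * c

  φ : ℚ → ℚ
  φ r = recip (node r) * c

  0<node : ∀ r → 0ℚ ≤ r → r ≤ 1ℚ → 0ℚ < node r
  0<node r 0≤r r≤1 with r ≟ 0ℚ
  ... | yes refl = subst (0ℚ <_) (sym (trans (cong (λ z → 1ℚ + z) (*-zeroˡ c)) (+-identityʳ 1ℚ))) (0<1/ 1)
  ... | no r≢0 = subst (0ℚ <_) (convex r x)
    (+-mono-≤-< (0≤q-p r≤1) (*-pos 0<r 0<x))
    where
    open +-*-Solver
    0<r : 0ℚ < r
    0<r = positive⁻¹ r {{nonNeg∧nonZero⇒pos r {{nonNegative 0≤r}} {{≢-nonZero r≢0}}}}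
    convex : ∀ r x → 1ℚ - r + r * x ≡ 1ℚ + r * (x - 1ℚ)
    convex = solve 2 (λ r x → con 1ℚ :- r :+ r :* x := con 1ℚ :+ r :* (x :- con 1ℚ)) refl

  anti : ∀ r s → 0ℚ ≤ r → r ≤ s → s ≤ 1ℚ → φ s ≤ φ r
  anti r s 0≤r r≤s s≤1 = reciprocal-anti (recip (node r)) (recip (node s)) r s c
    (<⇒≤ (recip-pos (node r) 0<r)) (<⇒≤ (recip-pos (node s) 0<s)) r≤s
    (recip-inverse (node r) 0<r) (recip-inverse (node s) 0<s)
    where
    0<r = 0<node r 0≤r (≤-trans r≤s s≤1)
    0<s = 0<node s (≤-trans 0≤r r≤s) s≤1

  open Antitone φ anti

  riemannSum≡U : ∀ m → riemannSum recip 1ℚ x (suc m) ≡ U m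
  riemannSum≡U m = Σ-cong (suc m) λ i →
    sym (*-assoc (recip (node (+ i / suc m))) c (+ 1 / suc m))

  log-cauchy : IsCauchy (λ m → riemannSum recip 1ℚ x (suc m))
  log-cauchy = IsCauchy-resp riemannSum≡U U-cauchy

-- The natural logarithm ∫₁ˣ dt/t of a positive rational x.  Since 1/t is
-- monotone between 1 and x, it is Riemann integrable there, so the uniform
-- left sums converge to the integral.
log : (x : ℚ) → 0ℚ < x → ℝ
log x 0<x = mkℝ (λ m → riemannSum recip 1ℚ x (suc m)) (Log.log-cauchy x 0<x)

0<1+1/_ : ∀ n .{{_ : ℕ.NonZero n}} → 0ℚ < 1ℚ + + 1 / n
0<1+1/ n = +-mono-< {0ℚ} {1ℚ} {0ℚ} (0<1/ 1) (0<1/ n)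

module Base (b : ℕ) .{{b>1 : ℕ.NonTrivial b}} where

  private instance
    b≢0 : ℕ.NonZero b
    b≢0 = ℕ.nonTrivial⇒nonZero b

  b^_≢0 : ∀ i → ℕ.NonZero (b ℕ.^ i)
  b^ i ≢0 = ℕ.m^n≢0 b i

  IsLength : ℕ → ℕ → Set
  IsLength n l = n ℕ.< b ℕ.^ l × (∀ i → n ℕ.< b ℕ.^ i → l ℕ.≤ i)

  private
    n<b^n : ∀ n → n ℕ.< b ℕ.^ n
    n<b^n zero    = ℕ.s≤s ℕ.z≤n
    n<b^n (suc n) = begin
      suc (suc n)              ≤⟨ ℕ.s≤s (n<b^n n) ⟩
      1 ℕ.+ b ℕ.^ n            ≤⟨ ℕ.+-monoˡ-≤ (b ℕ.^ n) (ℕ.m^n>0 b n) ⟩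
      b ℕ.^ n ℕ.+ b ℕ.^ n      ≡⟨ cong (b ℕ.^ n ℕ.+_) (sym (ℕ.+-identityʳ (b ℕ.^ n))) ⟩
      2 ℕ.* b ℕ.^ n            ≤⟨ ℕ.*-monoˡ-≤ (b ℕ.^ n) (ℕ.nonTrivial⇒n>1 b) ⟩
      b ℕ.* b ℕ.^ n            ∎
      where open ℕ.≤-Reasoning

    search : ∀ n fuel l → n ℕ.< b ℕ.^ (l ℕ.+ fuel) →
             (∀ i → n ℕ.< b ℕ.^ i → l ℕ.≤ i) → ∃ (IsLength n)
    search n zero l h below = l , subst (λ z → n ℕ.< b ℕ.^ z) (ℕ.+-identityʳ l) h , below
    search n (suc fuel) l h below with n ℕ.<? b ℕ.^ l
    ... | yes n<b^l = l , n<b^l , below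
    ... | no  n≮b^l = search n fuel (suc l) (subst (λ z → n ℕ.< b ℕ.^ z) (ℕ.+-suc l fuel) h)
      λ i n<b^i → ℕ.≤∧≢⇒< (below i n<b^i) λ { refl → n≮b^l n<b^i }

    length-exists : ∀ n → ∃ (IsLength n)
    length-exists n = search n n 0 (n<b^n n) λ _ _ → ℕ.z≤n

  len : ℕ → ℕ
  len n = proj₁ (length-exists n)

  len-isLength : ∀ n → IsLength n (len n)
  len-isLength n = proj₂ (length-exists n)

  -- The digits of n without leading zeros, least significant first; empty
  -- for n = 0.
  digits : ℕ → List ℕ
  digits n = map (λ i → ((n ℕ./ b ℕ.^ i) {{b^ i ≢0}}) ℕ.% b) (upTo (len n))

  count : Fin b → ℕ → ℕ
  count d n = length (filter (ℕ._≟ toℕ d) (digits n))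

  -- Used only for len m ≥ l; ∸ truncates otherwise.
  ld : ℕ → ℕ → ℕ
  ld l m = (m ℕ./ b ℕ.^ (len m ℕ.∸ l)) {{b^ (len m ℕ.∸ l) ≢0}}

  StartsWith : (l n m : ℕ) → Set
  StartsWith l n m = l ℕ.≤ len m × ld l m ≡ n

  Admissible : Fin b → (l n k m : ℕ) → Set
  Admissible d l n k m = StartsWith l n m × count d m ≡ k

  admissible? : ∀ d l n k → Decidable (Admissible d l n k)
  admissible? d l n k m = (l ℕ.≤? len m ×-dec ld l m ℕ.≟ n) ×-dec count d m ℕ.≟ k

{-# OPTIONS --safe #-}
-- The numbers q bʲ + r with r < bʲ are those obtained by appending j digits to
-- q.  Let f(k, j) and F(k, j) be the proportions of them with exactly k, and
-- with at most k, occurrences of d.  Appending one more random digit gives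
-- F(k, j+1) = F(k, j) - f(k, j) / b, so Σ_{j<J} f(k, j) = b (F(k, 0) - F(k, J)).
-- Since F(k, J) → 0, the total mass Σ_j f(k, j) is exactly b as soon as q itself
-- has at most k occurrences of d.  Explicitly, F(k, J) ≤ (k + 1) b / J: F is
-- antitone in J, and summing it over j gives the k + 1 masses Σ_j f(i, j) ≤ b.
--
-- Now split the admissible m according to their first l + p digits n bᵖ + v,
-- v < bᵖ.  For k ≥ l + p each v carries mass exactly b, so the sum of 1/m lies
-- between b Σ_v 1/(n bᵖ + v + 1) and b Σ_v 1/(n bᵖ + v), and the latter is b
-- times the left Riemann sum of log (1 + 1/n) with bᵖ pieces.
module Submission where

open import Defs
open import Data.Bool.Base using (true; false; _∧_; if_then_else_)
open import Data.Bool.Properties using (if-float)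
open import Data.Fin.Base using (Fin; toℕ)
open import Data.Fin.Properties using (toℕ<n)
import Data.Integer.Base as ℤ
open import Data.Integer.Base using (+_)
import Data.Integer.Properties as ℤ
open import Data.List.Base using (_∷_; map; upTo; applyUpTo; filter; length)
open import Data.List.Properties
  using (length-filter; length-map; length-upTo; map-cong; map-upTo)
open import Data.Nat.Base as ℕ using (ℕ; zero; suc)
import Data.Nat.DivMod as ℕ
import Data.Nat.Properties as ℕ
open import Data.Product.Base using (∃; _×_; _,_; proj₁; proj₂)
open import Data.Rational.Base
open import Data.Rational.Properties
open import Data.Rational.Solver using (module +-*-Solver)
import Data.Rational.Unnormalised.Base as ℚᵘ
open ℚᵘ using (mkℚᵘ)
import Data.Rational.Unnormalised.Properties as ℚᵘ
open import Data.Sum.Base using (inj₁; inj₂)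
open import Function.Base using (_∘_)
open import Relation.Binary.PropositionalEquality hiding (J)
open import Relation.Nullary.Decidable
  using (yes; no; does; dec-true; dec-false; _×-dec_)
open import Relation.Nullary.Negation using (¬_; contradiction)

-- Finite sums

Σ-cong< : ∀ n {f g : ℕ → ℚ} → (∀ i → i ℕ.< n → f i ≡ g i) → Σ< n f ≡ Σ< n g
Σ-cong< n f≡g = ≤-antisym
  (Σ-mono n λ i i<n → ≤-reflexive (f≡g i i<n))
  (Σ-mono n λ i i<n → ≤-reflexive (sym (f≡g i i<n)))

Σ-zero : ∀ n → Σ< n (λ _ → 0ℚ) ≡ 0ℚ
Σ-zero n = trans (Σ-const n 0ℚ) (*-zeroʳ (ι n))

Σ-nonNeg : ∀ n {f : ℕ → ℚ} → (∀ i → 0ℚ ≤ f i) → 0ℚ ≤ Σ< n f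
Σ-nonNeg n {f} 0≤f = subst (_≤ Σ< n f) (Σ-zero n) (Σ-mono n λ i _ → 0≤f i)

Σ-+ : ∀ n f g → Σ< n (λ i → f i + g i) ≡ Σ< n f + Σ< n g
Σ-+ zero    f g = refl
Σ-+ (suc n) f g = trans (cong (_+ (f n + g n)) (Σ-+ n f g))
  (interchange (Σ< n f) (Σ< n g) (f n) (g n))
  where
  open +-*-Solver
  interchange : ∀ p q r s → p + q + (r + s) ≡ p + r + (q + s)
  interchange = solve 4 (λ p q r s → p :+ q :+ (r :+ s) := p :+ r :+ (q :+ s)) refl

Σ-*ˡ : ∀ n c f → Σ< n (λ i → c * f i) ≡ c * Σ< n f
Σ-*ˡ zero    c f = sym (*-zeroʳ c)
Σ-*ˡ (suc n) c f = trans (cong (_+ c * f n) (Σ-*ˡ n c f)) (sym (*-distribˡ-+ c (Σ< n f) (f n)))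

Σ-*ʳ : ∀ n c f → Σ< n (λ i → f i * c) ≡ Σ< n f * c
Σ-*ʳ n c f = trans (Σ-cong n λ i → *-comm (f i) c) (trans (Σ-*ˡ n c f) (*-comm c (Σ< n f)))

Σ-swap : ∀ m n (f : ℕ → ℕ → ℚ) →
  Σ< m (λ i → Σ< n (λ j → f i j)) ≡ Σ< n (λ j → Σ< m (λ i → f i j))
Σ-swap zero    n f = sym (Σ-zero n)
Σ-swap (suc m) n f = trans (cong (_+ Σ< n (f m)) (Σ-swap m n f))
  (sym (Σ-+ n (λ j → Σ< m (λ i → f i j)) (f m)))

Σ-monoˡ : ∀ {m n} {f : ℕ → ℚ} → (∀ i → 0ℚ ≤ f i) → m ℕ.≤ n → Σ< m f ≤ Σ< n f
Σ-monoˡ {m} {n} {f} 0≤f m≤n = begin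
  Σ< m f                                         ≡⟨ +-identityʳ (Σ< m f) ⟨
  Σ< m f + 0ℚ                                    ≤⟨ +-monoʳ-≤ (Σ< m f) (Σ-nonNeg (n ℕ.∸ m) λ j → 0≤f (m ℕ.+ j)) ⟩
  Σ< m f + Σ< (n ℕ.∸ m) (λ j → f (m ℕ.+ j))      ≡⟨ Σ-split m (n ℕ.∸ m) f ⟨
  Σ< (m ℕ.+ (n ℕ.∸ m)) f                         ≡⟨ cong (λ z → Σ< z f) (ℕ.m+[n∸m]≡n m≤n) ⟩
  Σ< n f                                         ∎
  where open ≤-Reasoning

-- A single index turns a `y` into an `x`. Separating the correction `x - y` from the constant sum
-- gives the main term and the increment in `average-suc`.
Σ-if-≟ : ∀ n {d} → d ℕ.< n → ∀ x y →
  Σ< n (λ e → if does (e ℕ.≟ d) then x else y) ≡ ι n * y + (x - y)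
Σ-if-≟ (suc n) {d} d<1+n x y with ℕ.m≤n⇒m<n∨m≡n (ℕ.s≤s⁻¹ d<1+n)
... | inj₁ d<n rewrite dec-false (n ℕ.≟ d) (λ n≡d → ℕ.<⇒≢ d<n (sym n≡d)) = begin
  Σ< n (λ e → if does (e ℕ.≟ d) then x else y) + y   ≡⟨ cong (_+ y) (Σ-if-≟ n d<n x y) ⟩
  ι n * y + (x - y) + y                              ≡⟨ regroup (ι n) x y ⟩
  (ι n + 1ℚ) * y + (x - y)                           ≡⟨ cong (λ z → z * y + (x - y)) (ι-suc n) ⟨
  ι (suc n) * y + (x - y)                            ∎
  where
  open ≡-Reasoning
  open +-*-Solver
  regroup : ∀ u x y → u * y + (x - y) + y ≡ (u + 1ℚ) * y + (x - y)
  regroup = solve 3 (λ u x y → u :* y :+ (x :- y) :+ y := (u :+ con 1ℚ) :* y :+ (x :- y)) refl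
... | inj₂ refl rewrite dec-true (n ℕ.≟ n) refl = begin
  Σ< n (λ e → if does (e ℕ.≟ n) then x else y) + x   ≡⟨ cong (_+ x) (Σ-cong< n off) ⟩
  Σ< n (λ _ → y) + x                                 ≡⟨ cong (_+ x) (Σ-const n y) ⟩
  ι n * y + x                                        ≡⟨ regroup (ι n) x y ⟩
  (ι n + 1ℚ) * y + (x - y)                           ≡⟨ cong (λ z → z * y + (x - y)) (ι-suc n) ⟨
  ι (suc n) * y + (x - y)                            ∎
  where
  open ≡-Reasoning
  off : ∀ e → e ℕ.< n → (if does (e ℕ.≟ n) then x else y) ≡ y
  off e e<n rewrite dec-false (e ℕ.≟ n) (ℕ.<⇒≢ e<n) = refl
  open +-*-Solver
  regroup : ∀ u x y → u * y + x ≡ (u + 1ℚ) * y + (x - y)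
  regroup = solve 3 (λ u x y → u :* y :+ x := (u :+ con 1ℚ) :* y :+ (x :- y)) refl

p-q≤p : ∀ {p q} → 0ℚ ≤ q → p - q ≤ p
p-q≤p {p} {q} 0≤q = subst (p - q ≤_) (+-identityʳ p) (+-monoʳ-≤ p (neg-antimono-≤ 0≤q))

-- Reciprocals of natural numbers

-- Junk value inv 0 = 0, which makes inv multiplicative without side conditions.
inv : ℕ → ℚ
inv zero    = 0ℚ
inv (suc n) = + 1 / suc n

0≤ι : ∀ n → 0ℚ ≤ ι n
0≤ι n = nonNegative⁻¹ (ι n) {{normalize-nonNeg n 1}}

0≤inv : ∀ n → 0ℚ ≤ inv n
0≤inv zero    = ≤-refl
0≤inv (suc n) = <⇒≤ (0<1/ (suc n))

ι-+ : ∀ m n → ι (m ℕ.+ n) ≡ ι m + ι n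
ι-+ zero    n = sym (+-identityˡ (ι n))
ι-+ (suc m) n = begin
  ι (suc (m ℕ.+ n))     ≡⟨ ι-suc (m ℕ.+ n) ⟩
  ι (m ℕ.+ n) + 1ℚ      ≡⟨ cong (_+ 1ℚ) (ι-+ m n) ⟩
  ι m + ι n + 1ℚ        ≡⟨ swap (ι m) (ι n) ⟩
  ι m + 1ℚ + ι n        ≡⟨ cong (_+ ι n) (ι-suc m) ⟨
  ι (suc m) + ι n       ∎
  where
  open ≡-Reasoning
  open +-*-Solver
  swap : ∀ p q → p + q + 1ℚ ≡ p + 1ℚ + q
  swap = solve 2 (λ p q → p :+ q :+ con 1ℚ := p :+ con 1ℚ :+ q) refl

ι-* : ∀ m n → ι (m ℕ.* n) ≡ ι m * ι n
ι-* zero    n = sym (*-zeroˡ (ι n))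
ι-* (suc m) n = begin
  ι (n ℕ.+ m ℕ.* n)     ≡⟨ ι-+ n (m ℕ.* n) ⟩
  ι n + ι (m ℕ.* n)     ≡⟨ cong (λ z → ι n + z) (ι-* m n) ⟩
  ι n + ι m * ι n       ≡⟨ factor (ι m) (ι n) ⟩
  (ι m + 1ℚ) * ι n      ≡⟨ cong (_* ι n) (ι-suc m) ⟨
  ι (suc m) * ι n       ∎
  where
  open ≡-Reasoning
  open +-*-Solver
  factor : ∀ p q → q + p * q ≡ (p + 1ℚ) * q
  factor = solve 2 (λ p q → q :+ p :* q := (p :+ con 1ℚ) :* q) refl

ι*inv : ∀ n .{{_ : ℕ.NonZero n}} → ι n * inv n ≡ 1ℚ
ι*inv (suc n) = trans (cong (λ z → ι (suc n) * inv z) (sym (ℕ.*-identityˡ (suc n)))) (ι*1/ 0 n)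

ι*p≡1⇒p≡inv : ∀ n .{{_ : ℕ.NonZero n}} {p} → ι n * p ≡ 1ℚ → p ≡ inv n
ι*p≡1⇒p≡inv n {p} eq = begin
  p                      ≡⟨ *-identityʳ p ⟨
  p * 1ℚ                 ≡⟨ cong (p *_) (ι*inv n) ⟨
  p * (ι n * inv n)      ≡⟨ swap p (ι n) (inv n) ⟩
  ι n * p * inv n        ≡⟨ cong (_* inv n) eq ⟩
  1ℚ * inv n             ≡⟨ *-identityˡ (inv n) ⟩
  inv n                  ∎
  where
  open ≡-Reasoning
  open +-*-Solver
  swap : ∀ p q r → p * (q * r) ≡ q * p * r
  swap = solve 3 (λ p q r → p :* (q :* r) := q :* p :* r) refl

inv-* : ∀ m n → inv (m ℕ.* n) ≡ inv m * inv n
inv-* zero    n       = sym (*-zeroˡ (inv n))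
inv-* (suc m) zero    = trans (cong inv (ℕ.*-zeroʳ (suc m))) (sym (*-zeroʳ (inv (suc m))))
inv-* (suc m) (suc n) = sym (ι*p≡1⇒p≡inv (suc m ℕ.* suc n) (begin
  ι (suc m ℕ.* suc n) * (inv (suc m) * inv (suc n))
    ≡⟨ cong (_* (inv (suc m) * inv (suc n))) (ι-* (suc m) (suc n)) ⟩
  ι (suc m) * ι (suc n) * (inv (suc m) * inv (suc n))
    ≡⟨ interchange (ι (suc m)) (ι (suc n)) (inv (suc m)) (inv (suc n)) ⟩
  ι (suc m) * inv (suc m) * (ι (suc n) * inv (suc n))
    ≡⟨ cong₂ _*_ (ι*inv (suc m)) (ι*inv (suc n)) ⟩
  1ℚ * 1ℚ
    ≡⟨ *-identityˡ 1ℚ ⟩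
  1ℚ ∎))
  where
  open ≡-Reasoning
  open +-*-Solver
  interchange : ∀ p q r s → p * q * (r * s) ≡ p * r * (q * s)
  interchange = solve 4 (λ p q r s → p :* q :* (r :* s) := p :* r :* (q :* s)) refl

inv-anti : ∀ {m n} .{{_ : ℕ.NonZero m}} → m ℕ.≤ n → inv n ≤ inv m
inv-anti {suc m} {suc n} m≤n =
  /-mono 1 n 1 m (subst₂ ℕ._≤_ (sym (ℕ.*-identityˡ (suc m))) (sym (ℕ.*-identityˡ (suc n))) m≤n)

inv≤1 : ∀ n → inv n ≤ 1ℚ
inv≤1 zero    = <⇒≤ (0<1/ 1)
inv≤1 (suc n) = inv-anti {1} {suc n} (ℕ.s≤s ℕ.z≤n)

/≡ι*inv : ∀ i m → + i / suc m ≡ ι i * inv (suc m)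
/≡ι*inv i m = toℚᵘ-injective (begin
  toℚᵘ (+ i / suc m)                     ≈⟨ toℚᵘ-/ i m ⟩
  mkℚᵘ (+ i) m                           ≈⟨ ℚᵘ.*≡* eq ⟩
  mkℚᵘ (+ i) 0 ℚᵘ.* mkℚᵘ (+ 1) m         ≈⟨ ℚᵘ.*-cong (ℚᵘ.≃-sym (toℚᵘ-/ i 0)) (ℚᵘ.≃-sym (toℚᵘ-/ 1 m)) ⟩
  toℚᵘ (ι i) ℚᵘ.* toℚᵘ (inv (suc m))     ≈⟨ ℚᵘ.≃-sym (toℚᵘ-homo-* (ι i) (inv (suc m))) ⟩
  toℚᵘ (ι i * inv (suc m))               ∎)
  where
  open ℚᵘ.≃-Reasoning
  eq : + i ℤ.* + suc (m ℕ.+ 0) ≡ + i ℤ.* + 1 ℤ.* + suc m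
  eq = cong₂ ℤ._*_ (sym (ℤ.*-identityʳ (+ i))) (cong (λ z → + suc z) (ℕ.+-identityʳ m))

-- Indicators of c = k and of c ≤ k

-- Rational values let sums of indicators count, and the joint recursion on `c` and `k` makes the
-- identities below a matter of computation in each case.
exactly : ℕ → ℕ → ℚ
exactly zero    zero    = 1ℚ
exactly zero    (suc k) = 0ℚ
exactly (suc c) zero    = 0ℚ
exactly (suc c) (suc k) = exactly c k

atMost : ℕ → ℕ → ℚ
atMost zero    k       = 1ℚ
atMost (suc c) zero    = 0ℚ
atMost (suc c) (suc k) = atMost c k

exactly-≟ : ∀ c k p → (if does (c ℕ.≟ k) then p else 0ℚ) ≡ exactly c k * p
exactly-≟ zero    zero    p = sym (*-identityˡ p)
exactly-≟ zero    (suc k) p = sym (*-zeroˡ p)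
exactly-≟ (suc c) zero    p = sym (*-zeroˡ p)
exactly-≟ (suc c) (suc k) p = exactly-≟ c k p

0≤exactly : ∀ c k → 0ℚ ≤ exactly c k
0≤exactly zero    zero    = 0≤inv 1
0≤exactly zero    (suc k) = ≤-refl
0≤exactly (suc c) zero    = ≤-refl
0≤exactly (suc c) (suc k) = 0≤exactly c k

0≤atMost : ∀ c k → 0ℚ ≤ atMost c k
0≤atMost zero    k       = 0≤inv 1
0≤atMost (suc c) zero    = ≤-refl
0≤atMost (suc c) (suc k) = 0≤atMost c k

atMost≤1 : ∀ c k → atMost c k ≤ 1ℚ
atMost≤1 zero    k       = ≤-refl
atMost≤1 (suc c) zero    = 0≤inv 1
atMost≤1 (suc c) (suc k) = atMost≤1 c k

atMost≡1 : ∀ {c k} → c ℕ.≤ k → atMost c k ≡ 1ℚ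
atMost≡1 ℕ.z≤n       = refl
atMost≡1 (ℕ.s≤s c≤k) = atMost≡1 c≤k

exactly≡0 : ∀ {c k} → c ℕ.< k → exactly c k ≡ 0ℚ
exactly≡0 {zero}  {suc k} _           = refl
exactly≡0 {suc c} {suc k} (ℕ.s≤s c<k) = exactly≡0 c<k

atMost-zero : ∀ c → atMost c 0 ≡ exactly c 0
atMost-zero zero    = refl
atMost-zero (suc c) = refl

atMost-sucʳ : ∀ c k → atMost c (suc k) ≡ atMost c k + exactly c (suc k)
atMost-sucʳ zero    k       = sym (+-identityʳ 1ℚ)
atMost-sucʳ (suc c) zero    = trans (atMost-zero c) (sym (+-identityˡ (exactly c 0)))
atMost-sucʳ (suc c) (suc k) = atMost-sucʳ c k

-- Among the `c ≤ k`, raising `c` by one loses precisely the case `c = k`. This is the effect of an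
-- appended `d`, and the source of the recurrence for `cumulative`.
atMost-sucˡ : ∀ c k → atMost (suc c) k ≡ atMost c k - exactly c k
atMost-sucˡ zero    zero    = sym (p-p≡0 1ℚ)
atMost-sucˡ zero    (suc k) = sym (+-identityʳ 1ℚ)
atMost-sucˡ (suc c) zero    = sym (p-p≡0 0ℚ)
atMost-sucˡ (suc c) (suc k) = atMost-sucˡ c k

-- Convergence of a Cauchy sequence to its real

-- The Cauchy condition at `ε` bounds the distance between the entries `M` and `i`; letting `i` run
-- gives the distance from entry `M` to the real itself.
seq⟶ : ∀ x → (λ M → fromℚ (seq x M)) ⟶ x
seq⟶ x ε 0<ε with cauchy x ε 0<ε
... | N , bound = N , λ M N≤M η 0<η → N , λ i N≤i →
  ≤-trans (bound M i N≤M N≤i)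
    (subst (_≤ ε + η) (+-identityʳ ε) (+-monoʳ-≤ ε (<⇒≤ 0<η)))

-- Digits of q bʲ + r

module Digits (b : ℕ) .{{_ : ℕ.NonTrivial b}} where
  open Base b

  instance
    base≢0 : ℕ.NonZero b
    base≢0 = ℕ.nonTrivial⇒nonZero b

  infixl 7 _/^_

  _/^_ : ℕ → ℕ → ℕ
  m /^ i = (m ℕ./ b ℕ.^ i) {{b^ i ≢0}}

  n<b^n : ∀ n → n ℕ.< b ℕ.^ n
  n<b^n zero    = ℕ.≤-refl
  n<b^n (suc n) = begin
    suc (suc n)              ≤⟨ ℕ.+-mono-≤ (ℕ.m^n>0 b n) (n<b^n n) ⟩
    b ℕ.^ n ℕ.+ b ℕ.^ n      ≡⟨ cong (b ℕ.^ n ℕ.+_) (ℕ.+-identityʳ (b ℕ.^ n)) ⟨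
    2 ℕ.* b ℕ.^ n            ≤⟨ ℕ.*-monoˡ-≤ (b ℕ.^ n) (ℕ.nonTrivial⇒n>1 b) ⟩
    b ℕ.^ suc n              ∎
    where open ℕ.≤-Reasoning

  append≢0 : ∀ q .{{_ : ℕ.NonZero q}} j r → ℕ.NonZero (q ℕ.* b ℕ.^ j ℕ.+ r)
  append≢0 q j r = ℕ.>-nonZero (ℕ.<-≤-trans
    (ℕ.>-nonZero⁻¹ (q ℕ.* b ℕ.^ j) {{ℕ.m*n≢0 q (b ℕ.^ j)}})
    (ℕ.m≤m+n (q ℕ.* b ℕ.^ j) r))
    where instance _ = b^ j ≢0

  append< : ∀ q j {r} → r ℕ.< b ℕ.^ j → q ℕ.* b ℕ.^ j ℕ.+ r ℕ.< suc q ℕ.* b ℕ.^ j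
  append< q j {r} r<b^j = subst (q ℕ.* b ℕ.^ j ℕ.+ r ℕ.<_) (ℕ.+-comm (q ℕ.* b ℕ.^ j) (b ℕ.^ j))
    (ℕ.+-monoʳ-< (q ℕ.* b ℕ.^ j) r<b^j)

  append-/ : ∀ q j {r} → r ℕ.< b ℕ.^ j → (q ℕ.* b ℕ.^ j ℕ.+ r) /^ j ≡ q
  append-/ q j {r} r<b^j = ℕ.≤-antisym
    (ℕ.s≤s⁻¹ (ℕ.m<n*o⇒m/o<n {n = suc q} {b ℕ.^ j} (append< q j r<b^j)))
    (subst (ℕ._≤ (q ℕ.* b ℕ.^ j ℕ.+ r) /^ j) (ℕ.m*n/n≡m q (b ℕ.^ j))
      (ℕ./-monoˡ-≤ (b ℕ.^ j) (ℕ.m≤m+n (q ℕ.* b ℕ.^ j) r)))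
    where instance _ = b^ j ≢0

  IsLength-unique : ∀ {n l l′} → IsLength n l → IsLength n l′ → l ≡ l′
  IsLength-unique (n<b^l , l-least) (n<b^l′ , l′-least) =
    ℕ.≤-antisym (l-least _ n<b^l′) (l′-least _ n<b^l)

  -- From `q + 1 ≤ b^(len q)` follows `m < (q + 1) b^j ≤ b^(len q + j)`. Conversely `m < b^i` forces
  -- `j ≤ i`, since `b^j ≤ q b^j ≤ m` for nonzero `q`, and then `q < b^(i - j)`.
  len-append : ∀ q .{{_ : ℕ.NonZero q}} j {r} → r ℕ.< b ℕ.^ j →
    len (q ℕ.* b ℕ.^ j ℕ.+ r) ≡ len q ℕ.+ j
  len-append q j {r} r<b^j = IsLength-unique (len-isLength m) (upper , least)
    where
    open ℕ.≤-Reasoning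
    m = q ℕ.* b ℕ.^ j ℕ.+ r
    upper : m ℕ.< b ℕ.^ (len q ℕ.+ j)
    upper = begin-strict
      m                            <⟨ append< q j r<b^j ⟩
      suc q ℕ.* b ℕ.^ j            ≤⟨ ℕ.*-monoˡ-≤ (b ℕ.^ j) (proj₁ (len-isLength q)) ⟩
      b ℕ.^ len q ℕ.* b ℕ.^ j      ≡⟨ ℕ.^-distribˡ-+-* b (len q) j ⟨
      b ℕ.^ (len q ℕ.+ j)          ∎
    least : ∀ i → m ℕ.< b ℕ.^ i → len q ℕ.+ j ℕ.≤ i
    least i m<b^i with j ℕ.≤? i
    ... | yes j≤i = subst (len q ℕ.+ j ℕ.≤_) (ℕ.m∸n+n≡m j≤i) (ℕ.+-monoˡ-≤ j
      (proj₂ (len-isLength q) (i ℕ.∸ j) (ℕ.*-cancelʳ-< (b ℕ.^ j) q (b ℕ.^ (i ℕ.∸ j)) (begin-strict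
        q ℕ.* b ℕ.^ j                  ≤⟨ ℕ.m≤m+n (q ℕ.* b ℕ.^ j) r ⟩
        m                              <⟨ m<b^i ⟩
        b ℕ.^ i                        ≡⟨ cong (b ℕ.^_) (ℕ.m∸n+n≡m j≤i) ⟨
        b ℕ.^ (i ℕ.∸ j ℕ.+ j)          ≡⟨ ℕ.^-distribˡ-+-* b (i ℕ.∸ j) j ⟩
        b ℕ.^ (i ℕ.∸ j) ℕ.* b ℕ.^ j    ∎))))
    ... | no j≰i = contradiction m<b^i (ℕ.≤⇒≯ (begin
        b ℕ.^ i                        ≤⟨ ℕ.^-monoʳ-≤ b (ℕ.<⇒≤ (ℕ.≰⇒> j≰i)) ⟩
        b ℕ.^ j                        ≤⟨ ℕ.m≤n*m (b ℕ.^ j) q ⟩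
        q ℕ.* b ℕ.^ j                  ≤⟨ ℕ.m≤m+n (q ℕ.* b ℕ.^ j) r ⟩
        m                              ∎))

  startsWith-append : ∀ n .{{_ : ℕ.NonZero n}} j {r} → r ℕ.< b ℕ.^ j →
    StartsWith (len n) n (n ℕ.* b ℕ.^ j ℕ.+ r)
  startsWith-append n j {r} r<b^j = subst (len n ℕ.≤_) (sym len≡) (ℕ.m≤m+n (len n) j) , ld≡n
    where
    m = n ℕ.* b ℕ.^ j ℕ.+ r
    len≡ : len m ≡ len n ℕ.+ j
    len≡ = len-append n j r<b^j
    ld≡n : ld (len n) m ≡ n
    -- The exponent also occurs in the nonzero instance of the division, so it is abstracted
    -- together with its equation to `j`, and matching replaces both occurrences.
    ld≡n with len m ℕ.∸ len n | trans (cong (ℕ._∸ len n) len≡) (ℕ.m+n∸m≡n (len n) j)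
    ... | _ | refl = append-/ n j r<b^j

  -- Division with remainder, where `i` is the number of digits after the first `l`.
  startsWith⇒interval : ∀ {l n m} → StartsWith l n m →
    ∃ λ i → n ℕ.* b ℕ.^ i ℕ.≤ m × m ℕ.< suc n ℕ.* b ℕ.^ i
  startsWith⇒interval {l} {n} {m} (_ , refl) = i , ℕ.m/n*n≤m m (b ℕ.^ i) , m<
    where
    i = len m ℕ.∸ l
    instance _ = b^ i ≢0
    m< : m ℕ.< b ℕ.^ i ℕ.+ (m ℕ./ b ℕ.^ i) ℕ.* b ℕ.^ i
    m< = begin-strict
      m                                                      ≡⟨ ℕ.m≡m%n+[m/n]*n m (b ℕ.^ i) ⟩
      m ℕ.% b ℕ.^ i ℕ.+ (m ℕ./ b ℕ.^ i) ℕ.* b ℕ.^ i          <⟨ ℕ.+-monoˡ-< _ (ℕ.m%n<n m (b ℕ.^ i)) ⟩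
      b ℕ.^ i ℕ.+ (m ℕ./ b ℕ.^ i) ℕ.* b ℕ.^ i                ∎
      where open ℕ.≤-Reasoning

  -- From `n ≥ 1` and `b ≥ 2`: `n + 1 ≤ 2 n ≤ b n`. Hence the intervals from `n b^i` to
  -- `(n + 1) b^i` are disjoint and move up with `i`.
  suc≤*b : ∀ n .{{_ : ℕ.NonZero n}} i → suc n ℕ.* b ℕ.^ i ℕ.≤ n ℕ.* b ℕ.^ suc i
  suc≤*b n i = begin
    suc n ℕ.* b ℕ.^ i              ≤⟨ ℕ.*-monoˡ-≤ (b ℕ.^ i) (begin
        suc n                          ≤⟨ ℕ.+-monoˡ-≤ n (ℕ.>-nonZero⁻¹ n) ⟩
        n ℕ.+ n                        ≡⟨ cong (n ℕ.+_) (ℕ.+-identityʳ n) ⟨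
        2 ℕ.* n                        ≤⟨ ℕ.*-monoˡ-≤ n (ℕ.nonTrivial⇒n>1 b) ⟩
        b ℕ.* n                        ≡⟨ ℕ.*-comm b n ⟩
        n ℕ.* b                        ∎) ⟩
    n ℕ.* b ℕ.* b ℕ.^ i            ≡⟨ ℕ.*-assoc n b (b ℕ.^ i) ⟩
    n ℕ.* b ℕ.^ suc i              ∎
    where open ℕ.≤-Reasoning

  -- A prefix `n` would place `m` in the interval of some `i`. For `i ≤ j` that interval ends by
  -- `(n + 1) b^j`, and for `i > j` it starts at `n b^(j + 1)` or later.
  gap⇒¬startsWith : ∀ {l} n .{{_ : ℕ.NonZero n}} j {m} →
    suc n ℕ.* b ℕ.^ j ℕ.≤ m → m ℕ.< n ℕ.* b ℕ.^ suc j → ¬ StartsWith l n m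
  gap⇒¬startsWith n j {m} lower upper starts with startsWith⇒interval starts
  ... | i , nb^i≤m , m<[1+n]b^i with ℕ.≤-total i j
  ...   | inj₁ i≤j = ℕ.<⇒≱ m<[1+n]b^i
    (ℕ.≤-trans (ℕ.*-monoʳ-≤ (suc n) (ℕ.^-monoʳ-≤ b i≤j)) lower)
  ...   | inj₂ j≤i with ℕ.m≤n⇒m<n∨m≡n j≤i
  ...     | inj₁ j<i = ℕ.<⇒≱ upper
    (ℕ.≤-trans (ℕ.*-monoʳ-≤ n (ℕ.^-monoʳ-≤ b j<i)) nb^i≤m)
  ...     | inj₂ refl = ℕ.<⇒≱ m<[1+n]b^i lower

  below⇒¬startsWith : ∀ {l n m} → m ℕ.< n → ¬ StartsWith l n m
  below⇒¬startsWith {l} {n} {m} m<n (_ , ld≡n) =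
    ℕ.<⇒≱ m<n (subst (ℕ._≤ m) ld≡n (ℕ.m/n≤m m (b ℕ.^ (len m ℕ.∸ l)) {{b^ (len m ℕ.∸ l) ≢0}}))

  count≤len : ∀ d m → count d m ℕ.≤ len m
  count≤len d m = begin
    length (filter (ℕ._≟ toℕ d) (digits m))   ≤⟨ length-filter (ℕ._≟ toℕ d) (digits m) ⟩
    length (digits m)                         ≡⟨ length-map _ (upTo (len m)) ⟩
    length (upTo (len m))                     ≡⟨ length-upTo (len m) ⟩
    len m                                     ∎
    where open ℕ.≤-Reasoning

  digit : ℕ → ℕ → ℕ
  digit m i = (m /^ i) ℕ.% b

  -- The least significant digit comes first, so the new digit becomes the head; nonzero `q` keeps
  -- it from being a leading zero. The others are those of `q` because
  -- `m / b^(i + 1) = (m / b) / b^i = q / b^i`.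
  digits-append : ∀ q .{{_ : ℕ.NonZero q}} {e} → e ℕ.< b → digits (q ℕ.* b ℕ.+ e) ≡ e ∷ digits q
  digits-append q {e} e<b = begin
    map (digit m) (upTo (len m))                  ≡⟨ cong (λ z → map (digit m) (upTo z)) len≡ ⟩
    map (digit m) (upTo (suc (len q)))            ≡⟨ map-upTo (digit m) (suc (len q)) ⟩
    digit m 0 ∷ applyUpTo (digit m ∘ suc) (len q) ≡⟨ cong₂ _∷_ digit-0 (sym (map-upTo (digit m ∘ suc) (len q))) ⟩
    e ∷ map (digit m ∘ suc) (upTo (len q))        ≡⟨ cong (e ∷_) (map-cong digit-suc (upTo (len q))) ⟩
    e ∷ map (digit q) (upTo (len q))              ∎
    where
    open ≡-Reasoning
    m = q ℕ.* b ℕ.+ e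
    b^1≡b : b ℕ.^ 1 ≡ b
    b^1≡b = ℕ.*-identityʳ b
    e<b^1 : e ℕ.< b ℕ.^ 1
    e<b^1 = subst (e ℕ.<_) (sym b^1≡b) e<b
    len≡ : len m ≡ suc (len q)
    len≡ = trans (cong (λ z → len (q ℕ.* z ℕ.+ e)) (sym b^1≡b))
      (trans (len-append q 1 e<b^1) (ℕ.+-comm (len q) 1))
    digit-0 : digit m 0 ≡ e
    digit-0 = begin
      (m ℕ./ 1) ℕ.% b              ≡⟨ cong (ℕ._% b) (ℕ.n/1≡n m) ⟩
      m ℕ.% b                      ≡⟨ cong (ℕ._% b) (ℕ.+-comm (q ℕ.* b) e) ⟩
      (e ℕ.+ q ℕ.* b) ℕ.% b        ≡⟨ ℕ.[m+kn]%n≡m%n e q b ⟩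
      e ℕ.% b                      ≡⟨ ℕ.m<n⇒m%n≡m e<b ⟩
      e                            ∎
    m/b≡q : m ℕ./ b ≡ q
    m/b≡q = ℕ.≤-antisym
      (ℕ.s≤s⁻¹ (ℕ.m<n*o⇒m/o<n {n = suc q} {b} (subst (m ℕ.<_) (ℕ.+-comm (q ℕ.* b) b) (ℕ.+-monoʳ-< (q ℕ.* b) e<b))))
      (subst (ℕ._≤ m ℕ./ b) (ℕ.m*n/n≡m q b) (ℕ./-monoˡ-≤ b (ℕ.m≤m+n (q ℕ.* b) e)))
    digit-suc : ∀ i → digit m (suc i) ≡ digit q i
    digit-suc i = cong (ℕ._% b) (begin
      m /^ suc i            ≡⟨ ℕ.m/n/o≡m/[n*o] m b (b ℕ.^ i) ⟨
      m ℕ./ b /^ i          ≡⟨ cong (_/^ i) m/b≡q ⟩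
      q /^ i                ∎)
      where instance
        _ = b^ i ≢0
        _ = b^ (suc i) ≢0

  count-append : ∀ d q .{{_ : ℕ.NonZero q}} {e} → e ℕ.< b →
    count d (q ℕ.* b ℕ.+ e) ≡ (if does (e ℕ.≟ toℕ d) then suc (count d q) else count d q)
  count-append d q {e} e<b rewrite digits-append q e<b with does (e ℕ.≟ toℕ d)
  ... | true  = refl
  ... | false = refl

-- Averages over the bʲ numbers q bʲ + r

module Average (b : ℕ) .{{_ : ℕ.NonTrivial b}} (d : Fin b) where
  open Base b
  open Digits b

  -- `average j q h` is the expectation of `h` at the digit count after `j` uniform random digits
  -- are appended to `q`. A general `h` covers `density` and `cumulative` at once and makes their
  -- relations instances of linearity.
  total average : ℕ → ℕ → (ℕ → ℚ) → ℚ
  total   j q h = Σ< (b ℕ.^ j) (λ r → h (count d (q ℕ.* b ℕ.^ j ℕ.+ r)))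
  average j q h = total j q h * inv (b ℕ.^ j)

  average-nonNeg : ∀ j q {h} → (∀ c → 0ℚ ≤ h c) → 0ℚ ≤ average j q h
  average-nonNeg j q 0≤h = *-nonNeg (Σ-nonNeg (b ℕ.^ j) λ r → 0≤h _) (0≤inv (b ℕ.^ j))

  average-cong : ∀ j q {g h} → (∀ c → g c ≡ h c) → average j q g ≡ average j q h
  average-cong j q g≡h = cong (_* inv (b ℕ.^ j)) (Σ-cong (b ℕ.^ j) λ r → g≡h _)

  average-+ : ∀ j q g h → average j q (λ c → g c + h c) ≡ average j q g + average j q h
  average-+ j q g h = trans (cong (_* inv (b ℕ.^ j)) (Σ-+ (b ℕ.^ j) (λ r → g (c r)) (λ r → h (c r))))
    (*-distribʳ-+ (inv (b ℕ.^ j)) (total j q g) (total j q h))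
    where
    c : ℕ → ℕ
    c r = count d (q ℕ.* b ℕ.^ j ℕ.+ r)

  average-*ˡ : ∀ j q p h → average j q (λ c → p * h c) ≡ p * average j q h
  average-*ˡ j q p h = trans (cong (_* inv (b ℕ.^ j)) (Σ-*ˡ (b ℕ.^ j) p _))
    (*-assoc p (total j q h) (inv (b ℕ.^ j)))

  average-zero : ∀ q h → average 0 q h ≡ h (count d q)
  average-zero q h = trans (*-identityʳ _) (trans (+-identityˡ _)
    (cong (λ z → h (count d z)) (trans (ℕ.+-identityʳ (q ℕ.* 1)) (ℕ.*-identityʳ q))))

  -- Conditioning on the last digit: one of its `b` values raises the count by one and the others
  -- keep it, so `h` changes by `h (suc c) - h c` with probability `1/b`.
  average-suc : ∀ j q .{{_ : ℕ.NonZero q}} h →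
    average (suc j) q h ≡ average j q h + inv b * average j q (λ c → h (suc c) - h c)
  average-suc j q h = begin
    Σ< (b ℕ.* B) F * inv (b ℕ.* B)
      ≡⟨ cong₂ _*_ sum (inv-* b B) ⟩
    (ι b * H + Δ) * (inv b * inv B)
      ≡⟨ expand (ι b) (inv b) H Δ (inv B) ⟩
    ι b * inv b * (H * inv B) + inv b * (Δ * inv B)
      ≡⟨ cong (λ z → z * (H * inv B) + inv b * (Δ * inv B)) (ι*inv b) ⟩
    1ℚ * (H * inv B) + inv b * (Δ * inv B)
      ≡⟨ cong (_+ inv b * (Δ * inv B)) (*-identityˡ (H * inv B)) ⟩
    H * inv B + inv b * (Δ * inv B) ∎
    where
    open ≡-Reasoning
    B = b ℕ.^ j
    c : ℕ → ℕ
    c r = count d (q ℕ.* B ℕ.+ r)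
    F : ℕ → ℚ
    F r = h (count d (q ℕ.* (b ℕ.* B) ℕ.+ r))
    H = Σ< B (λ r → h (c r))
    Δ = Σ< B (λ r → h (suc (c r)) - h (c r))
    index : ∀ r e → q ℕ.* (b ℕ.* B) ℕ.+ (r ℕ.* b ℕ.+ e) ≡ (q ℕ.* B ℕ.+ r) ℕ.* b ℕ.+ e
    index r e = begin
      q ℕ.* (b ℕ.* B) ℕ.+ (r ℕ.* b ℕ.+ e)    ≡⟨ ℕ.+-assoc (q ℕ.* (b ℕ.* B)) (r ℕ.* b) e ⟨
      q ℕ.* (b ℕ.* B) ℕ.+ r ℕ.* b ℕ.+ e      ≡⟨ cong (λ z → q ℕ.* z ℕ.+ r ℕ.* b ℕ.+ e) (ℕ.*-comm b B) ⟩
      q ℕ.* (B ℕ.* b) ℕ.+ r ℕ.* b ℕ.+ e      ≡⟨ cong (λ z → z ℕ.+ r ℕ.* b ℕ.+ e) (ℕ.*-assoc q B b) ⟨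
      q ℕ.* B ℕ.* b ℕ.+ r ℕ.* b ℕ.+ e        ≡⟨ cong (ℕ._+ e) (ℕ.*-distribʳ-+ b (q ℕ.* B) r) ⟨
      (q ℕ.* B ℕ.+ r) ℕ.* b ℕ.+ e            ∎
    lastDigit : ∀ r e → e ℕ.< b →
      F (r ℕ.* b ℕ.+ e) ≡ (if does (e ℕ.≟ toℕ d) then h (suc (c r)) else h (c r))
    lastDigit r e e<b = begin
      h (count d (q ℕ.* (b ℕ.* B) ℕ.+ (r ℕ.* b ℕ.+ e)))
        ≡⟨ cong (λ z → h (count d z)) (index r e) ⟩
      h (count d ((q ℕ.* B ℕ.+ r) ℕ.* b ℕ.+ e))
        ≡⟨ cong h (count-append d (q ℕ.* B ℕ.+ r) {{append≢0 q j r}} e<b) ⟩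
      h (if does (e ℕ.≟ toℕ d) then suc (c r) else c r)
        ≡⟨ if-float h (does (e ℕ.≟ toℕ d)) ⟩
      (if does (e ℕ.≟ toℕ d) then h (suc (c r)) else h (c r)) ∎
    sum : Σ< (b ℕ.* B) F ≡ ι b * H + Δ
    sum = begin
      Σ< (b ℕ.* B) F
        ≡⟨ cong (λ z → Σ< z F) (ℕ.*-comm b B) ⟩
      Σ< (B ℕ.* b) F
        ≡⟨ Σ-blocks B b F ⟩
      Σ< B (λ r → Σ< b (λ e → F (r ℕ.* b ℕ.+ e)))
        ≡⟨ Σ-cong B (λ r → trans (Σ-cong< b (lastDigit r)) (Σ-if-≟ b (toℕ<n d) _ _)) ⟩
      Σ< B (λ r → ι b * h (c r) + (h (suc (c r)) - h (c r)))
        ≡⟨ Σ-+ B _ _ ⟩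
      Σ< B (λ r → ι b * h (c r)) + Δ
        ≡⟨ cong (_+ Δ) (Σ-*ˡ B (ι b) _) ⟩
      ι b * H + Δ ∎
    open +-*-Solver
    expand : ∀ u v x y w → (u * x + y) * (v * w) ≡ u * v * (x * w) + v * (y * w)
    expand = solve 5 (λ u v x y w →
      (u :* x :+ y) :* (v :* w) := u :* v :* (x :* w) :+ v :* (y :* w)) refl

  module _ (q : ℕ) .{{_ : ℕ.NonZero q}} where

    -- The proportions `f(k, j)` and `F(k, j)` for a fixed prefix `q`.
    density cumulative : ℕ → ℕ → ℚ
    density    k j = average j q (λ c → exactly c k)
    cumulative k j = average j q (λ c → atMost c k)

    0≤density : ∀ k j → 0ℚ ≤ density k j
    0≤density k j = average-nonNeg j q λ c → 0≤exactly c k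

    0≤cumulative : ∀ k j → 0ℚ ≤ cumulative k j
    0≤cumulative k j = average-nonNeg j q λ c → 0≤atMost c k

    cumulative-step : ∀ k j → cumulative k (suc j) ≡ cumulative k j - inv b * density k j
    cumulative-step k j = begin
      cumulative k (suc j)
        ≡⟨ average-suc j q (λ c → atMost c k) ⟩
      cumulative k j + inv b * average j q (λ c → atMost (suc c) k - atMost c k)
        ≡⟨ cong (λ z → cumulative k j + inv b * z) (average-cong j q λ c → difference c) ⟩
      cumulative k j + inv b * average j q (λ c → - 1ℚ * exactly c k)
        ≡⟨ cong (λ z → cumulative k j + inv b * z) (average-*ˡ j q (- 1ℚ) λ c → exactly c k) ⟩
      cumulative k j + inv b * (- 1ℚ * density k j)
        ≡⟨ negate (cumulative k j) (inv b) (density k j) ⟩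
      cumulative k j - inv b * density k j ∎
      where
      open ≡-Reasoning
      open +-*-Solver
      cancel : ∀ x y → x - y - x ≡ - 1ℚ * y
      cancel = solve 2 (λ x y → x :- y :- x := con (- 1ℚ) :* y) refl
      negate : ∀ x v y → x + v * (- 1ℚ * y) ≡ x - v * y
      negate = solve 3 (λ x v y → x :+ v :* (con (- 1ℚ) :* y) := x :- v :* y) refl
      difference : ∀ c → atMost (suc c) k - atMost c k ≡ - 1ℚ * exactly c k
      difference c = trans (cong (_- atMost c k) (atMost-sucˡ c k)) (cancel (atMost c k) (exactly c k))

    -- Each step of `cumulative` loses `density / b`, so the sum telescopes. The free starting point
    -- `i` serves both the total mass, at `0`, and the tail estimates.
    Σ-density : ∀ k i n →
      Σ< n (λ j → density k (i ℕ.+ j)) ≡ ι b * (cumulative k i - cumulative k (i ℕ.+ n))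
    Σ-density k i zero = sym (trans
      (cong (λ z → ι b * (cumulative k i - cumulative k z)) (ℕ.+-identityʳ i))
      (trans (cong (ι b *_) (p-p≡0 (cumulative k i))) (*-zeroʳ (ι b))))
    Σ-density k i (suc n) = begin
      Σ< n (λ j → density k (i ℕ.+ j)) + f
        ≡⟨ cong (_+ f) (Σ-density k i n) ⟩
      ι b * (C - C′) + f
        ≡⟨ cong (λ z → ι b * (C - C′) + z) (*-identityˡ f) ⟨
      ι b * (C - C′) + 1ℚ * f
        ≡⟨ cong (λ z → ι b * (C - C′) + z * f) (ι*inv b) ⟨
      ι b * (C - C′) + ι b * inv b * f
        ≡⟨ collect (ι b) (inv b) C C′ f ⟩
      ι b * (C - (C′ - inv b * f))
        ≡⟨ cong (λ z → ι b * (C - z)) (cumulative-step k (i ℕ.+ n)) ⟨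
      ι b * (C - cumulative k (suc (i ℕ.+ n)))
        ≡⟨ cong (λ z → ι b * (C - cumulative k z)) (ℕ.+-suc i n) ⟨
      ι b * (C - cumulative k (i ℕ.+ suc n)) ∎
      where
      open ≡-Reasoning
      f = density k (i ℕ.+ n)
      C = cumulative k i
      C′ = cumulative k (i ℕ.+ n)
      open +-*-Solver
      collect : ∀ u v x y z → u * (x - y) + u * v * z ≡ u * (x - (y - v * z))
      collect = solve 5 (λ u v x y z →
        u :* (x :- y) :+ u :* v :* z := u :* (x :- (y :- v :* z))) refl

    cumulative≡1 : ∀ {k} → count d q ℕ.≤ k → cumulative k 0 ≡ 1ℚ
    cumulative≡1 {k} c≤k = trans (average-zero q (λ c → atMost c k)) (atMost≡1 c≤k)

    cumulative-zero≤1 : ∀ k → cumulative k 0 ≤ 1ℚ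
    cumulative-zero≤1 k = subst (_≤ 1ℚ) (sym (average-zero q (λ c → atMost c k))) (atMost≤1 (count d q) k)

    Σ-density≤ : ∀ k i n → Σ< n (λ j → density k (i ℕ.+ j)) ≤ ι b * cumulative k i
    Σ-density≤ k i n = subst (_≤ ι b * cumulative k i) (sym (Σ-density k i n))
      (*-monoˡ (0≤ι b) (p-q≤p (0≤cumulative k (i ℕ.+ n))))

    Σ-density≤b : ∀ k n → Σ< n (density k) ≤ ι b
    Σ-density≤b k n = ≤-trans (Σ-density≤ k 0 n)
      (subst (ι b * cumulative k 0 ≤_) (*-identityʳ (ι b)) (*-monoˡ (0≤ι b) (cumulative-zero≤1 k)))

    cumulative-anti : ∀ k {i j} → i ℕ.≤ j → cumulative k j ≤ cumulative k i
    cumulative-anti k {i} {j} i≤j = subst (λ z → cumulative k z ≤ cumulative k i) (ℕ.m+[n∸m]≡n i≤j) (go (j ℕ.∸ i))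
      where
      go : ∀ n → cumulative k (i ℕ.+ n) ≤ cumulative k i
      go zero    = ≤-reflexive (cong (cumulative k) (ℕ.+-identityʳ i))
      go (suc n) = begin
        cumulative k (i ℕ.+ suc n)        ≡⟨ cong (cumulative k) (ℕ.+-suc i n) ⟩
        cumulative k (suc (i ℕ.+ n))      ≡⟨ cumulative-step k (i ℕ.+ n) ⟩
        cumulative k (i ℕ.+ n) - inv b * density k (i ℕ.+ n)
                                          ≤⟨ p-q≤p (*-nonNeg (0≤inv b) (0≤density k (i ℕ.+ n))) ⟩
        cumulative k (i ℕ.+ n)            ≤⟨ go n ⟩
        cumulative k i                    ∎
        where open ≤-Reasoning

    Σ-cumulative≤ : ∀ k n → Σ< n (cumulative k) ≤ ι (suc k) * ι b
    Σ-cumulative≤ zero n = begin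
      Σ< n (cumulative 0)      ≡⟨ Σ-cong n (λ j → average-cong j q atMost-zero) ⟩
      Σ< n (density 0)         ≤⟨ Σ-density≤b 0 n ⟩
      ι b                      ≡⟨ *-identityˡ (ι b) ⟨
      ι 1 * ι b                ∎
      where open ≤-Reasoning
    Σ-cumulative≤ (suc k) n = begin
      Σ< n (cumulative (suc k))
        ≡⟨ Σ-cong n (λ j → trans (average-cong j q λ c → atMost-sucʳ c k) (average-+ j q (λ c → atMost c k) (λ c → exactly c (suc k)))) ⟩
      Σ< n (λ j → cumulative k j + density (suc k) j)
        ≡⟨ Σ-+ n (cumulative k) (density (suc k)) ⟩
      Σ< n (cumulative k) + Σ< n (density (suc k))
        ≤⟨ +-mono-≤ (Σ-cumulative≤ k n) (Σ-density≤b (suc k) n) ⟩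
      ι (suc k) * ι b + ι b
        ≡⟨ factor (ι (suc k)) (ι b) ⟩
      (ι (suc k) + 1ℚ) * ι b
        ≡⟨ cong (_* ι b) (ι-suc (suc k)) ⟨
      ι (suc (suc k)) * ι b ∎
      where
      open ≤-Reasoning
      open +-*-Solver
      factor : ∀ p q → p * q + q ≡ (p + 1ℚ) * q
      factor = solve 2 (λ p q → p :* q :+ q := (p :+ con 1ℚ) :* q) refl

    -- Σ-cumulative≤ bounds the sum of n terms of an antitone sequence, hence n
    -- times the last of them.
    cumulative≤ : ∀ k n .{{_ : ℕ.NonZero n}} → cumulative k n ≤ ι (suc k) * ι b * inv n
    cumulative≤ k n = begin
      C                              ≡⟨ *-identityˡ C ⟨
      1ℚ * C                         ≡⟨ cong (_* C) (ι*inv n) ⟨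
      ι n * inv n * C                ≡⟨ swap (ι n) (inv n) C ⟩
      ι n * C * inv n                ≡⟨ cong (_* inv n) (Σ-const n C) ⟨
      Σ< n (λ _ → C) * inv n         ≤⟨ *-monoʳ (0≤inv n) (Σ-mono n λ j j<n → cumulative-anti k (ℕ.<⇒≤ j<n)) ⟩
      Σ< n (cumulative k) * inv n    ≤⟨ *-monoʳ (0≤inv n) (Σ-cumulative≤ k n) ⟩
      ι (suc k) * ι b * inv n        ∎
      where
      open ≤-Reasoning
      C = cumulative k n
      open +-*-Solver
      swap : ∀ p q r → p * q * r ≡ p * r * q
      swap = solve 3 (λ p q r → p :* q :* r := p :* r :* q) refl

-- Sums of reciprocals by length

module Level (b : ℕ) .{{_ : ℕ.NonTrivial b}} (d : Fin b) (k : ℕ) where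
  open Base b
  open Digits b
  open Average b d

  term : ℕ → ℚ
  term m = exactly (count d m) k * inv m

  -- For nonzero `q`, this collects the terms of the `m` of length `len q + j` that start with `q`.
  level : ℕ → ℕ → ℚ
  level q j = Σ< (b ℕ.^ j) λ r → term (q ℕ.* b ℕ.^ j ℕ.+ r)

  -- Within a level, `1/m` is compared with `1/(s b^j)`, where `s = q` gives the upper bound and
  -- `s = q + 1` the lower. Both bounds reduce to this evaluation.
  Σ-exactly*inv : ∀ q .{{_ : ℕ.NonZero q}} j s →
    Σ< (b ℕ.^ j) (λ r → exactly (count d (q ℕ.* b ℕ.^ j ℕ.+ r)) k * inv (s ℕ.* b ℕ.^ j)) ≡
    density q k j * inv s
  Σ-exactly*inv q j s = begin
    Σ< B (λ r → exactly (count d (q ℕ.* B ℕ.+ r)) k * inv (s ℕ.* B))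
      ≡⟨ Σ-*ʳ B (inv (s ℕ.* B)) (λ r → exactly (count d (q ℕ.* B ℕ.+ r)) k) ⟩
    N * inv (s ℕ.* B)
      ≡⟨ cong (N *_) (inv-* s B) ⟩
    N * (inv s * inv B)
      ≡⟨ swap N (inv s) (inv B) ⟩
    N * inv B * inv s ∎
    where
    open ≡-Reasoning
    B = b ℕ.^ j
    N = total j q (λ c → exactly c k)
    open +-*-Solver
    swap : ∀ x y z → x * (y * z) ≡ x * z * y
    swap = solve 3 (λ x y z → x :* (y :* z) := x :* z :* y) refl

  level≤ : ∀ q .{{_ : ℕ.NonZero q}} j → level q j ≤ density q k j * inv q
  level≤ q {{q≢0}} j = subst (level q j ≤_) (Σ-exactly*inv q j q) (Σ-mono (b ℕ.^ j) λ r _ →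
    *-monoˡ (0≤exactly (count d (q ℕ.* b ℕ.^ j ℕ.+ r)) k)
      (inv-anti {{ℕ.m*n≢0 q (b ℕ.^ j) {{q≢0}} {{b^ j ≢0}}}} (ℕ.m≤m+n (q ℕ.* b ℕ.^ j) r)))

  level≥ : ∀ q .{{_ : ℕ.NonZero q}} j → density q k j * inv (suc q) ≤ level q j
  level≥ q j = subst (_≤ level q j) (Σ-exactly*inv q j (suc q)) (Σ-mono (b ℕ.^ j) λ r r<b^j →
    *-monoˡ (0≤exactly (count d (q ℕ.* b ℕ.^ j ℕ.+ r)) k)
      (inv-anti {{append≢0 q j r}} (ℕ.<⇒≤ (append< q j r<b^j))))

  -- Appending `p + j` digits means appending `p` digits `v` and then `j` more, which refines the
  -- prefix `q` to `q b^p + v`.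
  level-split : ∀ q p j → level q (p ℕ.+ j) ≡ Σ< (b ℕ.^ p) λ v → level (q ℕ.* b ℕ.^ p ℕ.+ v) j
  level-split q p j = begin
    Σ< (b ℕ.^ (p ℕ.+ j)) (λ r → term (q ℕ.* b ℕ.^ (p ℕ.+ j) ℕ.+ r))
      ≡⟨ cong (λ z → Σ< z (λ r → term (q ℕ.* z ℕ.+ r))) (ℕ.^-distribˡ-+-* b p j) ⟩
    Σ< (P ℕ.* J) (λ r → term (q ℕ.* (P ℕ.* J) ℕ.+ r))
      ≡⟨ Σ-blocks P J (λ r → term (q ℕ.* (P ℕ.* J) ℕ.+ r)) ⟩
    Σ< P (λ v → Σ< J (λ r → term (q ℕ.* (P ℕ.* J) ℕ.+ (v ℕ.* J ℕ.+ r))))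
      ≡⟨ Σ-cong P (λ v → Σ-cong J (λ r → cong term (index v r))) ⟩
    Σ< P (λ v → level (q ℕ.* P ℕ.+ v) j) ∎
    where
    open ≡-Reasoning
    P = b ℕ.^ p
    J = b ℕ.^ j
    index : ∀ v r → q ℕ.* (P ℕ.* J) ℕ.+ (v ℕ.* J ℕ.+ r) ≡ (q ℕ.* P ℕ.+ v) ℕ.* J ℕ.+ r
    index v r = begin
      q ℕ.* (P ℕ.* J) ℕ.+ (v ℕ.* J ℕ.+ r)    ≡⟨ ℕ.+-assoc (q ℕ.* (P ℕ.* J)) (v ℕ.* J) r ⟨
      q ℕ.* (P ℕ.* J) ℕ.+ v ℕ.* J ℕ.+ r      ≡⟨ cong (λ z → z ℕ.+ v ℕ.* J ℕ.+ r) (ℕ.*-assoc q P J) ⟨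
      q ℕ.* P ℕ.* J ℕ.+ v ℕ.* J ℕ.+ r        ≡⟨ cong (ℕ._+ r) (ℕ.*-distribʳ-+ J (q ℕ.* P) v) ⟨
      (q ℕ.* P ℕ.+ v) ℕ.* J ℕ.+ r            ∎

  count-append≤ : ∀ q .{{_ : ℕ.NonZero q}} j {r} → r ℕ.< b ℕ.^ j →
    count d (q ℕ.* b ℕ.^ j ℕ.+ r) ℕ.≤ len q ℕ.+ j
  count-append≤ q j {r} r<b^j =
    subst (count d (q ℕ.* b ℕ.^ j ℕ.+ r) ℕ.≤_) (len-append q j r<b^j) (count≤len d (q ℕ.* b ℕ.^ j ℕ.+ r))

  -- All these `m` have length `len q + j`, too short for `k` occurrences of `d`.
  level≡0 : ∀ q .{{_ : ℕ.NonZero q}} j → len q ℕ.+ j ℕ.< k → level q j ≡ 0ℚ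
  level≡0 q j len+j<k = trans
    (Σ-cong< (b ℕ.^ j) λ r r<b^j → trans
      (cong (_* inv (q ℕ.* b ℕ.^ j ℕ.+ r)) (exactly≡0 (ℕ.≤-<-trans (count-append≤ q j r<b^j) len+j<k)))
      (*-zeroˡ (inv (q ℕ.* b ℕ.^ j ℕ.+ r))))
    (Σ-zero (b ℕ.^ j))

  -- This is `b` times the bound of `cumulative≤`, so it dominates the mass from level `J` on. It
  -- does not depend on the prefix and tends to `0` as `J` grows.
  tail-bound : ℕ → ℚ
  tail-bound J = ι b * (ι (suc k) * ι b * inv J)

  0≤tail-bound : ∀ J → 0ℚ ≤ tail-bound J
  0≤tail-bound J = *-nonNeg (0≤ι b) (*-nonNeg (*-nonNeg (0≤ι (suc k)) (0≤ι b)) (0≤inv J))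

  Σ-level-tail : ∀ q .{{_ : ℕ.NonZero q}} J .{{_ : ℕ.NonZero J}} n →
    Σ< n (λ j → level q (J ℕ.+ j)) ≤ tail-bound J
  Σ-level-tail q J n = begin
    Σ< n (λ j → level q (J ℕ.+ j))           ≤⟨ Σ-mono n (λ j _ → level≤density (J ℕ.+ j)) ⟩
    Σ< n (λ j → density q k (J ℕ.+ j))       ≤⟨ Σ-density≤ q k J n ⟩
    ι b * cumulative q k J                   ≤⟨ *-monoˡ (0≤ι b) (cumulative≤ q k J) ⟩
    tail-bound J                             ∎
    where
    open ≤-Reasoning
    level≤density : ∀ j → level q j ≤ density q k j
    level≤density j = ≤-trans (level≤ q j)
      (subst (density q k j * inv q ≤_) (*-identityʳ (density q k j))
        (*-monoˡ (0≤density q k j) (inv≤1 q)))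

  -- The condition on `k` works twice: the levels below `p` vanish because their numbers have fewer
  -- than `k` digits, and each prefix `q v` with `v < B`, having `len n + p` digits, contains at
  -- most `k` occurrences of `d` and so carries the full mass `b`.
  module _ (n : ℕ) .{{n≢0 : ℕ.NonZero n}} (p : ℕ) (len+p≤k : len n ℕ.+ p ℕ.≤ k) where
    private
      B = b ℕ.^ p
      q : ℕ → ℕ
      q v = n ℕ.* B ℕ.+ v
      q≢0 : ∀ v → ℕ.NonZero (q v)
      q≢0 v = append≢0 n p v

    Σ-reciprocals : ℚ
    Σ-reciprocals = Σ< B (λ v → inv (q v))

    Σ-level-split : ∀ J → Σ< (p ℕ.+ J) (level n) ≡ Σ< B (λ v → Σ< J (level (q v)))
    Σ-level-split J = begin
      Σ< (p ℕ.+ J) (level n)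
        ≡⟨ Σ-split p J (level n) ⟩
      Σ< p (level n) + Σ< J (λ j → level n (p ℕ.+ j))
        ≡⟨ cong₂ _+_ short (Σ-cong J (level-split n p)) ⟩
      0ℚ + Σ< J (λ j → Σ< B (λ v → level (q v) j))
        ≡⟨ +-identityˡ _ ⟩
      Σ< J (λ j → Σ< B (λ v → level (q v) j))
        ≡⟨ Σ-swap J B _ ⟩
      Σ< B (λ v → Σ< J (level (q v))) ∎
      where
      open ≡-Reasoning
      short : Σ< p (level n) ≡ 0ℚ
      short = trans
        (Σ-cong< p λ j j<p → level≡0 n j (ℕ.<-≤-trans (ℕ.+-monoʳ-< (len n) j<p) len+p≤k))
        (Σ-zero p)

    Σ-level-upper : ∀ J → Σ< (p ℕ.+ J) (level n) ≤ ι b * Σ-reciprocals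
    Σ-level-upper J = begin
      Σ< (p ℕ.+ J) (level n)                 ≡⟨ Σ-level-split J ⟩
      Σ< B (λ v → Σ< J (level (q v)))        ≤⟨ Σ-mono B (λ v _ → upper v) ⟩
      Σ< B (λ v → ι b * inv (q v))           ≡⟨ Σ-*ˡ B (ι b) _ ⟩
      ι b * Σ-reciprocals                    ∎
      where
      open ≤-Reasoning
      upper : ∀ v → Σ< J (level (q v)) ≤ ι b * inv (q v)
      upper v = begin
        Σ< J (level (q v))                         ≤⟨ Σ-mono J (λ j _ → level≤ (q v) j) ⟩
        Σ< J (λ j → density (q v) k j * inv (q v)) ≡⟨ Σ-*ʳ J (inv (q v)) (density (q v) k) ⟩
        Σ< J (density (q v) k) * inv (q v)         ≤⟨ *-monoʳ (0≤inv (q v)) (Σ-density≤b (q v) k J) ⟩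
        ι b * inv (q v)                            ∎
        where instance _ = q≢0 v

    -- The two sums differ by the telescoped amount `1/q(0) - 1/q(B)`, which is at most
    -- `1/q(0) ≤ 1/B`.
    Σ-inv-suc≥ : Σ-reciprocals - inv B ≤ Σ< B (λ v → inv (suc (q v)))
    Σ-inv-suc≥ = begin
      Σ-reciprocals - inv B
        ≤⟨ +-monoʳ-≤ Σ-reciprocals (neg-antimono-≤ inv-q0≤inv-B) ⟩
      Σ-reciprocals - inv (q 0)
        ≡⟨ cong (_- inv (q 0)) (+-identityʳ Σ-reciprocals) ⟨
      Σ-reciprocals + 0ℚ - inv (q 0)
        ≤⟨ +-monoˡ-≤ (- inv (q 0)) (+-monoʳ-≤ Σ-reciprocals (0≤inv (q B))) ⟩
      Σ-reciprocals + inv (q B) - inv (q 0)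
        ≡⟨ cong (_- inv (q 0)) (Σ-shift B (λ v → inv (q v))) ⟩
      inv (q 0) + V - inv (q 0)
        ≡⟨ cancel (inv (q 0)) V ⟩
      V
        ≡⟨ Σ-cong B (λ v → cong inv (ℕ.+-suc (n ℕ.* B) v)) ⟩
      Σ< B (λ v → inv (suc (q v))) ∎
      where
      open ≤-Reasoning
      V = Σ< B (λ v → inv (q (suc v)))
      inv-q0≤inv-B : inv (q 0) ≤ inv B
      inv-q0≤inv-B = inv-anti {{b^ p ≢0}} (ℕ.≤-trans (ℕ.m≤n*m B n) (ℕ.m≤m+n (n ℕ.* B) 0))
      open +-*-Solver
      cancel : ∀ x y → x + y - x ≡ y
      cancel = solve 2 (λ x y → x :+ y :- x := y) refl

    -- Stopping at level `J` leaves each prefix the mass `b (1 - F(k, J))`. With weight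
    -- `1/(q v + 1) ≤ 1/B` the loss is at most `tail-bound J / B` per prefix, hence at most
    -- `tail-bound J` over the `B` prefixes.
    Σ-level-lower : ∀ J .{{_ : ℕ.NonZero J}} →
      ι b * (Σ-reciprocals - inv B) - tail-bound J ≤ Σ< (p ℕ.+ J) (level n)
    Σ-level-lower J = begin
      ι b * (Σ-reciprocals - inv B) - τ
        ≤⟨ +-monoˡ-≤ (- τ) (*-monoˡ (0≤ι b) Σ-inv-suc≥) ⟩
      ι b * Σ< B (λ v → inv (suc (q v))) - τ
        ≡⟨ cong (λ z → ι b * Σ< B (λ v → inv (suc (q v))) + z) spread-τ ⟩
      ι b * Σ< B (λ v → inv (suc (q v))) + Σ< B (λ _ → - (τ * inv B))
        ≡⟨ cong (_+ Σ< B (λ _ → - (τ * inv B))) (Σ-*ˡ B (ι b) (λ v → inv (suc (q v)))) ⟨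
      Σ< B (λ v → ι b * inv (suc (q v))) + Σ< B (λ _ → - (τ * inv B))
        ≡⟨ Σ-+ B (λ v → ι b * inv (suc (q v))) (λ _ → - (τ * inv B)) ⟨
      Σ< B (λ v → ι b * inv (suc (q v)) - τ * inv B)
        ≤⟨ Σ-mono B lower ⟩
      Σ< B (λ v → Σ< J (level (q v)))
        ≡⟨ Σ-level-split J ⟨
      Σ< (p ℕ.+ J) (level n) ∎
      where
      open ≤-Reasoning
      open +-*-Solver
      τ = tail-bound J
      spread-τ : - τ ≡ Σ< B (λ _ → - (τ * inv B))
      spread-τ = sym (trans (Σ-const B (- (τ * inv B)))
        (trans (swap (ι B) τ (inv B))
          (trans (cong (λ z → - (z * τ)) (ι*inv B {{b^ p ≢0}})) (cong -_ (*-identityˡ τ)))))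
        where
        swap : ∀ x y z → x * - (y * z) ≡ - (x * z * y)
        swap = solve 3 (λ x y z → x :* :- (y :* z) := :- (x :* z :* y)) refl
      expand : ∀ x y z → x * (1ℚ - y) * z ≡ x * z - x * y * z
      expand = solve 3 (λ x y z → x :* (con 1ℚ :- y) :* z := x :* z :- x :* y :* z) refl
      lower : ∀ v → v ℕ.< B → ι b * inv (suc (q v)) - τ * inv B ≤ Σ< J (level (q v))
      lower v v<B = begin
        ι b * w - τ * inv B
          ≤⟨ +-monoʳ-≤ (ι b * w) (neg-antimono-≤ (*-monoˡ (0≤tail-bound J) w≤inv-B)) ⟩
        ι b * w - τ * w
          ≡⟨ expand (ι b) ρ w ⟨
        ι b * (1ℚ - ρ) * w
          ≤⟨ *-monoʳ (0≤inv (suc (q v))) (*-monoˡ (0≤ι b) (+-monoʳ-≤ 1ℚ (neg-antimono-≤ (cumulative≤ (q v) k J)))) ⟩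
        ι b * (1ℚ - cumulative (q v) k J) * w
          ≡⟨ cong (λ z → ι b * (z - cumulative (q v) k J) * w) (cumulative≡1 (q v) (ℕ.≤-trans (count-append≤ n p v<B) len+p≤k)) ⟨
        ι b * (cumulative (q v) k 0 - cumulative (q v) k J) * w
          ≡⟨ cong (_* w) (Σ-density (q v) k 0 J) ⟨
        Σ< J (density (q v) k) * w
          ≡⟨ Σ-*ʳ J w (density (q v) k) ⟨
        Σ< J (λ j → density (q v) k j * w)
          ≤⟨ Σ-mono J (λ j _ → level≥ (q v) j) ⟩
        Σ< J (level (q v)) ∎
        where
        instance _ = q≢0 v
        w = inv (suc (q v))
        ρ = ι (suc k) * ι b * inv J
        w≤inv-B : w ≤ inv B
        w≤inv-B = inv-anti {{b^ p ≢0}}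
          (ℕ.m≤n⇒m≤1+n (ℕ.≤-trans (ℕ.m≤n*m B n) (ℕ.m≤m+n (n ℕ.* B) v)))

-- The sum over the admissible integers

module Admissible (b : ℕ) .{{_ : ℕ.NonTrivial b}} (d : Fin b) (n : ℕ) .{{n≢0 : ℕ.NonZero n}} (k : ℕ) where
  open Base b
  open Digits b
  open Level b d k

  -- With `inv m` for `1/m` the term is defined, and zero, at `m = 0`, so that sums can start from
  -- `0` and be cut at the points `n b^J`.
  admissibleTerm : ℕ → ℚ
  admissibleTerm m = if does (admissible? d (len n) n k m) then inv m else 0ℚ

  0≤admissibleTerm : ∀ m → 0ℚ ≤ admissibleTerm m
  0≤admissibleTerm m with does (admissible? d (len n) n k m)
  ... | true  = 0≤inv m
  ... | false = ≤-refl

  startsWith⇒term : ∀ {m} → StartsWith (len n) n m → admissibleTerm m ≡ term m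
  startsWith⇒term {m} starts = trans
    (cong (λ z → if z ∧ does (count d m ℕ.≟ k) then inv m else 0ℚ)
      (dec-true (len n ℕ.≤? len m ×-dec ld (len n) m ℕ.≟ n) starts))
    (exactly-≟ (count d m) k (inv m))

  ¬startsWith⇒0 : ∀ {m} → ¬ StartsWith (len n) n m → admissibleTerm m ≡ 0ℚ
  ¬startsWith⇒0 {m} ¬starts =
    cong (λ z → if z ∧ does (count d m ℕ.≟ k) then inv m else 0ℚ)
      (dec-false (len n ℕ.≤? len m ×-dec ld (len n) m ℕ.≟ n) ¬starts)

  -- Below `n b^J`, the numbers starting with `n` fill the intervals from `n b^j` to `(n + 1) b^j`
  -- with `j < J`, and each interval is a level. The numbers below `n` and those in the gaps
  -- contribute nothing.
  Σ-admissibleTerm : ∀ J → Σ< (n ℕ.* b ℕ.^ J) admissibleTerm ≡ Σ< J (level n)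
  Σ-admissibleTerm zero = trans
    (cong (λ z → Σ< z admissibleTerm) (ℕ.*-identityʳ n))
    (trans (Σ-cong< n λ m m<n → ¬startsWith⇒0 (below⇒¬startsWith {len n} m<n)) (Σ-zero n))
  Σ-admissibleTerm (suc J) = begin
    Σ< (n ℕ.* b ℕ.^ suc J) admissibleTerm
      ≡⟨ cong (λ z → Σ< z admissibleTerm) (ℕ.m+[n∸m]≡n nB+B≤) ⟨
    Σ< (n ℕ.* B ℕ.+ B ℕ.+ gap) admissibleTerm
      ≡⟨ Σ-split (n ℕ.* B ℕ.+ B) gap admissibleTerm ⟩
    Σ< (n ℕ.* B ℕ.+ B) admissibleTerm + Σ< gap (λ i → admissibleTerm (n ℕ.* B ℕ.+ B ℕ.+ i))
      ≡⟨ cong₂ _+_ (Σ-split (n ℕ.* B) B admissibleTerm) (trans (Σ-cong< gap in-gap) (Σ-zero gap)) ⟩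
    Σ< (n ℕ.* B) admissibleTerm + Σ< B (λ r → admissibleTerm (n ℕ.* B ℕ.+ r)) + 0ℚ
      ≡⟨ +-identityʳ _ ⟩
    Σ< (n ℕ.* B) admissibleTerm + Σ< B (λ r → admissibleTerm (n ℕ.* B ℕ.+ r))
      ≡⟨ cong₂ _+_ (Σ-admissibleTerm J)
           (Σ-cong< B λ r r<B → startsWith⇒term (startsWith-append n J r<B)) ⟩
    Σ< J (level n) + level n J ∎
    where
    open ≡-Reasoning
    B = b ℕ.^ J
    gap = n ℕ.* b ℕ.^ suc J ℕ.∸ (n ℕ.* B ℕ.+ B)
    nB+B≡ : n ℕ.* B ℕ.+ B ≡ suc n ℕ.* B
    nB+B≡ = ℕ.+-comm (n ℕ.* B) B
    nB+B≤ : n ℕ.* B ℕ.+ B ℕ.≤ n ℕ.* b ℕ.^ suc J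
    nB+B≤ = subst (ℕ._≤ n ℕ.* b ℕ.^ suc J) (sym nB+B≡) (suc≤*b n J)
    in-gap : ∀ i → i ℕ.< gap → admissibleTerm (n ℕ.* B ℕ.+ B ℕ.+ i) ≡ 0ℚ
    in-gap i i<gap = ¬startsWith⇒0 (gap⇒¬startsWith {len n} n J
      (subst (ℕ._≤ n ℕ.* B ℕ.+ B ℕ.+ i) nB+B≡ (ℕ.m≤m+n (n ℕ.* B ℕ.+ B) i))
      (subst (n ℕ.* B ℕ.+ B ℕ.+ i ℕ.<_) (ℕ.m+[n∸m]≡n nB+B≤) (ℕ.+-monoʳ-< (n ℕ.* B ℕ.+ B) i<gap)))

  partialSum : ℕ → ℚ
  partialSum i = Σ< i (λ m → admissibleTerm (suc m))

  partialSum≡ : ∀ i → partialSum i ≡ Σ< (suc i) admissibleTerm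
  partialSum≡ i = begin
    partialSum i                          ≡⟨ +-identityˡ (partialSum i) ⟨
    0ℚ + partialSum i                     ≡⟨ cong (_+ partialSum i) (¬startsWith⇒0 (below⇒¬startsWith {len n} (ℕ.>-nonZero⁻¹ n))) ⟨
    admissibleTerm 0 + partialSum i       ≡⟨ Σ-shift i admissibleTerm ⟨
    Σ< (suc i) admissibleTerm             ∎
    where open ≡-Reasoning

  Σ-level≤partialSum : ∀ J {i} → n ℕ.* b ℕ.^ J ℕ.≤ i → Σ< J (level n) ≤ partialSum i
  Σ-level≤partialSum J {i} nb^J≤i = subst₂ _≤_ (Σ-admissibleTerm J) (sym (partialSum≡ i))
    (Σ-monoˡ 0≤admissibleTerm (ℕ.m≤n⇒m≤1+n nb^J≤i))

  -- Since `i < b^(J + i + 1)`, these levels cover all `m ≤ i`. The extra `J` allows the levels to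
  -- be split at a chosen `J` afterwards.
  partialSum≤Σ-level : ∀ J i → partialSum i ≤ Σ< (J ℕ.+ suc i) (level n)
  partialSum≤Σ-level J i = subst₂ _≤_ (sym (partialSum≡ i)) (Σ-admissibleTerm (J ℕ.+ suc i))
    (Σ-monoˡ 0≤admissibleTerm (begin
      suc i                           ≤⟨ ℕ.m≤n+m (suc i) J ⟩
      J ℕ.+ suc i                     ≤⟨ ℕ.<⇒≤ (n<b^n (J ℕ.+ suc i)) ⟩
      b ℕ.^ (J ℕ.+ suc i)             ≤⟨ ℕ.m≤n*m (b ℕ.^ (J ℕ.+ suc i)) n ⟩
      n ℕ.* b ℕ.^ (J ℕ.+ suc i)       ∎))
    where open ℕ.≤-Reasoning

  tail-bound-small : ∀ ε → 0ℚ < ε → ∃ λ J → tail-bound (suc J) ≤ ε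
  tail-bound-small ε 0<ε =
    let J , small = archimedean (ι b * (ι (suc k) * ι b)) ε
          (*-nonNeg (0≤ι b) (*-nonNeg (0≤ι (suc k)) (0≤ι b))) 0<ε
    in J , subst (_≤ ε) (*-assoc (ι b) (ι (suc k) * ι b) (inv (suc J))) (small J ℕ.≤-refl)

  -- One-sided, so only `j` has to be large: the first `J` levels lie in `partialSum j`, and the
  -- others add up to at most `tail-bound J`. Applied in both orders it gives the Cauchy property.
  partialSum-diff : ∀ {ε} J .{{_ : ℕ.NonZero J}} → tail-bound J ≤ ε →
    ∀ i j → n ℕ.* b ℕ.^ J ℕ.≤ j → partialSum i - partialSum j ≤ ε
  partialSum-diff {ε} J small i j N≤j = q-p≤r (begin
    partialSum i
      ≤⟨ partialSum≤Σ-level J i ⟩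
    Σ< (J ℕ.+ suc i) (level n)
      ≡⟨ Σ-split J (suc i) (level n) ⟩
    Σ< J (level n) + Σ< (suc i) (λ j → level n (J ℕ.+ j))
      ≤⟨ +-mono-≤ (Σ-level≤partialSum J N≤j) (≤-trans (Σ-level-tail n J (suc i)) small) ⟩
    partialSum j + ε ∎)
    where open ≤-Reasoning

  partialSum-cauchy : IsCauchy partialSum
  partialSum-cauchy ε 0<ε =
    let J , small = tail-bound-small ε 0<ε in
    n ℕ.* b ℕ.^ suc J , λ i j N≤i N≤j → ∣p∣≤r
      (partialSum-diff (suc J) small i j N≤j)
      (subst (_≤ ε) (flip (partialSum j) (partialSum i)) (partialSum-diff (suc J) small j i N≤i))
    where
    open +-*-Solver
    flip : ∀ p q → p - q ≡ - (q - p)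
    flip = solve 2 (λ p q → p :- q := :- (q :- p)) refl

  S : ℝ
  S = mkℝ partialSum partialSum-cauchy

  -- `inv (suc m)` computes to `+ 1 / suc m`, so the partial sums in `HasSum` are the sequence of
  -- `S` itself.
  hasSum : HasSum (admissible? d (len n) n k) (λ m → + 1 / m) S
  hasSum = seq⟶ S

-- Riemann sums of log (1 + 1/n)

module RiemannSum (n : ℕ) where

  x = 1ℚ + + 1 / suc n

  open Log x (0<1+1/ suc n)
  open Antitone φ anti public

  -- With `N = suc n` and `M = suc m`, the node at `v/M` equals `(N M + v)/(N M)` and the interval
  -- of integration has length `1/N`, so each summand is `(N M)/(N M + v) * 1/(N M) = 1/(N M + v)`.
  U≡Σ-inv : ∀ m → U m ≡ Σ< (suc m) (λ v → inv (suc n ℕ.* suc m ℕ.+ v))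
  U≡Σ-inv m = Σ-cong< (suc m) λ v v<M → ι*p≡1⇒p≡inv (suc n ℕ.* suc m ℕ.+ v) (begin
    ι (K v) * (recip (y v) * c * inv (suc m))
      ≡⟨ cong (λ z → ι (K v) * (recip (y v) * z * inv (suc m))) c≡inv ⟩
    ι (K v) * (recip (y v) * inv (suc n) * inv (suc m))
      ≡⟨ swap (ι (K v)) (recip (y v)) (inv (suc n)) (inv (suc m)) ⟩
    ι (K v) * (inv (suc n) * inv (suc m)) * recip (y v)
      ≡⟨ cong (_* recip (y v)) (y≡ v) ⟨
    y v * recip (y v)
      ≡⟨ recip-inverse (y v) (0<node (+ v / suc m) (0≤/ v m) (/≤1 v m (ℕ.<⇒≤ v<M))) ⟩
    1ℚ ∎)
    where
    open ≡-Reasoning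
    open +-*-Solver
    K : ℕ → ℕ
    K v = suc n ℕ.* suc m ℕ.+ v
    y : ℕ → ℚ
    y v = node (+ v / suc m)
    c≡inv : c ≡ inv (suc n)
    c≡inv = cancel (inv (suc n))
      where
      cancel : ∀ p → 1ℚ + p - 1ℚ ≡ p
      cancel = solve 1 (λ p → con 1ℚ :+ p :- con 1ℚ := p) refl
    swap : ∀ p q r s → p * (q * r * s) ≡ p * (r * s) * q
    swap = solve 4 (λ p q r s → p :* (q :* r :* s) := p :* (r :* s) :* q) refl
    expand : ∀ p q r s t → (p * q + t) * (r * s) ≡ p * r * (q * s) + t * s * r
    expand = solve 5 (λ p q r s t →
      (p :* q :+ t) :* (r :* s) := p :* r :* (q :* s) :+ t :* s :* r) refl
    y≡ : ∀ v → y v ≡ ι (K v) * (inv (suc n) * inv (suc m))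
    y≡ v = sym (begin
      ι (K v) * (inv (suc n) * inv (suc m))
        ≡⟨ cong (_* (inv (suc n) * inv (suc m)))
             (trans (ι-+ (suc n ℕ.* suc m) v) (cong (_+ ι v) (ι-* (suc n) (suc m)))) ⟩
      (ι (suc n) * ι (suc m) + ι v) * (inv (suc n) * inv (suc m))
        ≡⟨ expand (ι (suc n)) (ι (suc m)) (inv (suc n)) (inv (suc m)) (ι v) ⟩
      ι (suc n) * inv (suc n) * (ι (suc m) * inv (suc m)) + ι v * inv (suc m) * inv (suc n)
        ≡⟨ cong₂ _+_ (cong₂ _*_ (ι*inv (suc n)) (ι*inv (suc m)))
             (cong₂ _*_ (sym (/≡ι*inv v m)) (sym c≡inv)) ⟩
      1ℚ * 1ℚ + + v / suc m * c
        ≡⟨ cong (_+ + v / suc m * c) (*-identityˡ 1ℚ) ⟩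
      y v ∎)

-- The limit as k grows

module Limit (b : ℕ) .{{_ : ℕ.NonTrivial b}} (d : Fin b) (n : ℕ) where
  open Base b
  open Digits b
  open RiemannSum n
  module A (k : ℕ) = Admissible b d (suc n) k

  limit : ℝ
  limit = ι b · log x (0<1+1/ suc n)

  -- The index `i` is at once the cut-off of the series and the index of the approximation `U i` to
  -- the logarithm. The error has three parts: `b C / (m + 1)` between `U m` and `U i`,
  -- `b / (m + 1)` from replacing `1/q` by `1/(q + 1)` over the prefixes `q`, and the truncated
  -- tail, which is at most `η`.
  within-limit : ∀ {ε} k p m → suc m ≡ b ℕ.^ p → len (suc n) ℕ.+ p ℕ.≤ k →
    ι b * (C + 1ℚ) * inv (suc m) ≤ ε → Within ε (A.S k) limit
  -- Beyond the first bound the partial sum contains the first `p + J + 1` levels. Beyond the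
  -- second, `U i` has at least `b^p` pieces, which gives `U i - U m ≤ C / b^p`.
  within-limit {ε} k p m 1+m≡b^p len+p≤k small η 0<η = suc n ℕ.* b ℕ.^ (p ℕ.+ suc J) ℕ.⊔ m , λ i N≤i →
    subst (λ z → ∣ partialSum i - ι b * z ∣ ≤ ε + η) (sym (Log.riemannSum≡U x (0<1+1/ suc n) i))
      (∣p∣≤r (upper i) (lower i
        (ℕ.≤-trans (ℕ.m≤m⊔n (suc n ℕ.* b ℕ.^ (p ℕ.+ suc J)) m) N≤i)
        (ℕ.≤-trans (ℕ.m≤n⊔m (suc n ℕ.* b ℕ.^ (p ℕ.+ suc J)) m) N≤i)))
    where
    open A k
    open Level b d k
    J = proj₁ (tail-bound-small η 0<η)
    τ≤η : tail-bound (suc J) ≤ η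
    τ≤η = proj₂ (tail-bound-small η 0<η)
    open ≤-Reasoning
    open +-*-Solver
    w = inv (suc m)
    τ = tail-bound (suc J)
    Σ-reciprocals≡U : Σ-reciprocals (suc n) p len+p≤k ≡ U m
    Σ-reciprocals≡U = sym (trans (U≡Σ-inv m)
      (cong (λ z → Σ< z (λ v → inv (suc n ℕ.* z ℕ.+ v))) 1+m≡b^p))
    upper : ∀ i → partialSum i - ι b * U i ≤ ε + η
    upper i = begin
      partialSum i - ι b * U i
        ≤⟨ +-monoˡ-≤ (- (ι b * U i)) (≤-trans (partialSum≤Σ-level p i) (Σ-level-upper (suc n) p len+p≤k (suc i))) ⟩
      ι b * Σ-reciprocals (suc n) p len+p≤k - ι b * U i
        ≡⟨ cong (λ z → ι b * z - ι b * U i) Σ-reciprocals≡U ⟩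
      ι b * U m - ι b * U i
        ≡⟨ factor (ι b) (U m) (U i) ⟩
      ι b * (U m - U i)
        ≤⟨ *-monoˡ (0≤ι b) (diff-≤ m i) ⟩
      ι b * (C * w)
        ≡⟨ trans (sym (+-identityʳ _)) (cong (λ z → z + 0ℚ) (sym (*-assoc (ι b) C w))) ⟩
      ι b * C * w + 0ℚ
        -- The upper estimate produces only `b C w`; `b w` is added to reach the bound common to
        -- both directions.
        ≤⟨ +-monoʳ-≤ (ι b * C * w) (*-nonNeg (0≤ι b) (0≤inv (suc m))) ⟩
      ι b * C * w + ι b * w
        ≡⟨ collect (ι b) C w ⟩
      ι b * (C + 1ℚ) * w
        ≤⟨ small ⟩
      ε
        ≡⟨ +-identityʳ ε ⟨
      ε + 0ℚ
        ≤⟨ +-monoʳ-≤ ε (<⇒≤ 0<η) ⟩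
      ε + η ∎
      where
      factor : ∀ p q r → p * q - p * r ≡ p * (q - r)
      factor = solve 3 (λ p q r → p :* q :- p :* r := p :* (q :- r)) refl
      collect : ∀ p q r → p * q * r + p * r ≡ p * (q + 1ℚ) * r
      collect = solve 3 (λ p q r → p :* q :* r :+ p :* r := p :* (q :+ con 1ℚ) :* r) refl
    lower : ∀ i → suc n ℕ.* b ℕ.^ (p ℕ.+ suc J) ℕ.≤ i → m ℕ.≤ i → - (partialSum i - ι b * U i) ≤ ε + η
    lower i N≤i m≤i = begin
      - (partialSum i - ι b * U i)
        ≡⟨ flip (partialSum i) (ι b * U i) ⟩
      ι b * U i - partialSum i
        ≤⟨ +-monoʳ-≤ (ι b * U i) (neg-antimono-≤ (≤-trans (Σ-level-lower (suc n) p len+p≤k (suc J)) (Σ-level≤partialSum (p ℕ.+ suc J) N≤i))) ⟩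
      ι b * U i - (ι b * (Σ-reciprocals (suc n) p len+p≤k - inv (b ℕ.^ p)) - τ)
        ≡⟨ cong₂ (λ y z → ι b * U i - (ι b * (y - inv z) - τ)) Σ-reciprocals≡U (sym 1+m≡b^p) ⟩
      ι b * U i - (ι b * (U m - w) - τ)
        ≡⟨ regroup (ι b) (U i) (U m) w τ ⟩
      ι b * (U i - U m + w) + τ
        ≤⟨ +-mono-≤ (*-monoˡ (0≤ι b) (+-monoˡ-≤ w Ui-Um≤)) τ≤η ⟩
      ι b * (C * w + w) + η
        ≡⟨ cong (_+ η) (collect (ι b) C w) ⟩
      ι b * (C + 1ℚ) * w + η
        ≤⟨ +-monoˡ-≤ η small ⟩
      ε + η ∎
      where
      flip : ∀ p q → - (p - q) ≡ q - p
      flip = solve 2 (λ p q → :- (p :- q) := q :- p) refl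
      regroup : ∀ u x y z t → u * x - (u * (y - z) - t) ≡ u * (x - y + z) + t
      regroup = solve 5 (λ u x y z t →
        u :* x :- (u :* (y :- z) :- t) := u :* (x :- y :+ z) :+ t) refl
      collect : ∀ p q r → p * (q * r + r) ≡ p * (q + 1ℚ) * r
      collect = solve 3 (λ p q r → p :* (q :* r :+ r) := p :* (q :+ con 1ℚ) :* r) refl
      Ui-Um≤ : U i - U m ≤ C * w
      Ui-Um≤ = ≤-trans (diff-≤ i m) (*-monoˡ 0≤C (inv-anti {suc m} {suc i} (ℕ.s≤s m≤i)))

  S⟶limit : A.S ⟶ limit
  S⟶limit ε 0<ε =
    -- `p` is both the number of digits after the prefix and the Archimedean threshold: as
    -- `p < b^p`, the index `b^p - 1` is at least `p`.
    let p , small = archimedean (ι b * (C + 1ℚ)) ε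
          (*-nonNeg (0≤ι b) (+-mono-≤ 0≤C (0≤inv 1))) 0<ε
    in len (suc n) ℕ.+ p , λ k K≤k → within-limit k p (ℕ.pred (b ℕ.^ p)) (ℕ.suc-pred (b ℕ.^ p) {{b^ p ≢0}}) K≤k
      (small (ℕ.pred (b ℕ.^ p)) (ℕ.<⇒≤pred (n<b^n p)))

mainTheorem16 : (b : ℕ) .{{_ : ℕ.NonTrivial b}} (d : Fin b) (n : ℕ) .{{_ : ℕ.NonZero n}} (l : ℕ) →
    Base.len b n ≡ l →
    ∃ λ (S : ℕ → ℝ) →
    (∀ k → HasSum (Base.admissible? b d l n k) (λ m → + 1 / m) (S k)) ×
    S ⟶ (+ b / 1) · log (1ℚ + (+ 1 / n)) (0<1+1/ n)
mainTheorem16 b d (suc n) _ refl = A.S , A.hasSum , S⟶limit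
  where open Limit b d n
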